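{- There is an absolute constant $c>0$ such that for every integer $n\ge2$ and every $d$: if there is a symmetric torus polynomial $\{0,1\}^n\to\mathbb{T}$ of degree $d$ that $\frac{1}{20n}$-approximates $\mathrm{Maj}_n$, then $d\ge c\sqrt{\frac{n}{\log n}}$.
   Context: Let $\mathbb{T}=\mathbb{R}/\mathbb{Z}$. For $z\in\mathbb{T}$, $|z \bmod 1|$ denotes $|\iota(z)|$, where $\iota(z)$ is the unique representative of $z$ in $[-1/2,1/2)$. For $F:\{0,1\}^n\to\mathbb{T}$, $\|F \bmod 1\|_\infty=\max_{x\in\{0,1\}^n}|F(x)\bmod 1|$. A torus polynomial of degree (at most) $d$ is a function $P:\{0,1\}^n\to\mathbb{T}$ of the form $P(x)=\sum_{S\subseteq[n],|S|\le d}P_S\prod_{i\in S}x_i \bmod 1$ with $P_S\in\mathbb{R}$. It is symmetric if it is given by a symmetric real polynomial of degree at most $d$ evaluated modulo one (i.e. the coefficients $P_S$ can be taken to depend only on $|S|$). It $\varepsilon$-approximates $f:\{0,1\}^n\to\{0,1\}$ if $\|P-\tfrac{f}{2}\bmod 1\|_\infty\le\varepsilon$. For $x\in\{0,1\}^n$, $|x|=\sum_i x_i$. $\mathrm{Maj}_n:\{0,1\}^n\to\{0,1\}$ is defined by $\mathrm{Maj}_n(x)=1$ if $|x|\ge n/2$ and $0$ otherwise. -}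

module Defs where

open import Algebra.Bundles.Raw using (RawMonoid)
open import Algebra.Definitions.RawMonoid using () renaming (_×_ to multiple)
open import Data.Bool using (Bool; if_then_else_)
open import Data.Fin.Subset using (Subset; inside; outside) renaming (∣_∣ to size)
open import Data.Integer as ℤ using (ℤ; +_)
import Data.Integer.Properties as ℤ
open import Data.List using (List; []; _∷_; _++_; map; filter; foldr; product; tabulate)
open import Data.Nat as ℕ using (ℕ; zero; suc)
import Data.Nat.Properties as ℕ
open import Data.Product as × using (Σ-syntax; ∃; ∃-syntax; _×_; _,_; proj₁; proj₂)
open import Data.Rational
open import Data.Rational.Properties
open import Data.Rational.Solver using (module +-*-Solver)
open import Data.Sum as ⊎ using (_⊎_; inj₁; inj₂; swap)
open import Data.Vec as Vec using (Vec; lookup)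
open import Level using (0ℓ) renaming (suc to lsuc)
open import Relation.Binary.PropositionalEquality
  using (_≡_; refl; sym; trans; cong; cong₂; subst; subst₂)
open import Relation.Nullary using (yes; no; contradiction)

open +-*-Solver using (solve; _:=_; con; _:+_; _:*_; _:-_; :-_)

private
  variable
    p q r : ℚ

module ℚ-Lemmas where

  times : ℕ → ℚ → ℚ
  times zero    h = 0ℚ
  times (suc n) h = h + times n h

  recip : ∀ p → 0ℚ < p → ℚ
  recip p 0<p = (1/ p) {{pos⇒nonZero p {{positive 0<p}}}}

  abstract

    p-1<p : ∀ p → p - 1ℚ < p
    p-1<p p = subst (p - 1ℚ <_) (+-identityʳ p) (+-monoʳ-< p (negative⁻¹ (- 1ℚ)))

    p<p+1 : ∀ p → p < p + 1ℚ
    p<p+1 p = subst (_< p + 1ℚ) (+-identityʳ p) (+-monoʳ-< p (positive⁻¹ 1ℚ))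

    neg-neg : ∀ p → - (- p) ≡ p
    neg-neg = solve 1 (λ p → :- (:- p) := p) refl

    p<-q⇒q<-p : p < - q → q < - p
    p<-q⇒q<-p {p} {q} p<-q = subst (_< - p) (neg-neg q) (neg-antimono-< p<-q)

    -p<q⇒-q<p : - p < q → - q < p
    -p<q⇒-q<p {p} {q} -p<q = subst (- q <_) (neg-neg p) (neg-antimono-< -p<q)

    p<q⇒0<q-p : p < q → 0ℚ < q - p
    p<q⇒0<q-p {p} {q} p<q = subst (_< q - p) (+-inverseʳ p) (+-monoˡ-< (- p) p<q)

    q-r≤p⇒q≤p+r : ∀ p q r → q - r ≤ p → q ≤ p + r
    q-r≤p⇒q≤p+r p q r le =
      subst (_≤ p + r) (solve 2 (λ q r → q :- r :+ r := q) refl q r) (+-monoˡ-≤ r le)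

    *-monoˡ-≤-0≤ : ∀ r p q → 0ℚ ≤ r → p ≤ q → p * r ≤ q * r
    *-monoˡ-≤-0≤ r p q 0≤r = *-monoʳ-≤-nonNeg r {{nonNegative 0≤r}} {p} {q}

    *-monoʳ-≤-0≤ : ∀ r p q → 0ℚ ≤ r → p ≤ q → r * p ≤ r * q
    *-monoʳ-≤-0≤ r p q 0≤r = *-monoˡ-≤-nonNeg r {{nonNegative 0≤r}} {p} {q}

    *-monoˡ-<-0< : ∀ r p q → 0ℚ < r → p < q → p * r < q * r
    *-monoˡ-<-0< r p q 0<r = *-monoˡ-<-pos r {{positive 0<r}} {p} {q}

    *-monoʳ-<-0< : ∀ r p q → 0ℚ < r → p < q → r * p < r * q
    *-monoʳ-<-0< r p q 0<r = *-monoʳ-<-pos r {{positive 0<r}} {p} {q}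

    squares-< : 0ℚ ≤ q → p * p < q * q → p < q
    squares-< {q} {p} 0≤q p²<q² with p <? q
    ... | yes p<q = p<q
    ... | no  p≮q = contradiction (<-≤-trans p²<q² q²≤p²) (<-irrefl refl)
      where
      q≤p : q ≤ p
      q≤p = ≮⇒≥ p≮q
      q²≤p² : q * q ≤ p * p
      q²≤p² = ≤-trans (*-monoˡ-≤-0≤ q q p 0≤q q≤p) (*-monoʳ-≤-0≤ p q p (≤-trans 0≤q q≤p) q≤p)

    *-recip : ∀ p (0<p : 0ℚ < p) → p * recip p 0<p ≡ 1ℚ
    *-recip p 0<p = *-inverseʳ p {{pos⇒nonZero p {{positive 0<p}}}}

    recip-pos : ∀ p (0<p : 0ℚ < p) → 0ℚ < recip p 0<p
    recip-pos p 0<p = positive⁻¹ (recip p 0<p) {{1/pos⇒pos p {{positive 0<p}}}}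

    recip-anti-< : ∀ (0<p : 0ℚ < p) (0<q : 0ℚ < q) → p < q → recip q 0<q < recip p 0<p
    recip-anti-< {p} {q} 0<p 0<q p<q =
      *-cancelˡ-<-nonNeg q {{pos⇒nonNeg q {{positive 0<q}}}} {recip q 0<q} {recip p 0<p}
        (subst (_< q * recip p 0<p) (trans (*-recip p 0<p) (sym (*-recip q 0<q)))
          (*-monoˡ-<-0< (recip p 0<p) p q (recip-pos p 0<p) p<q))

    recip-recip : ∀ p (0<p : 0ℚ < p) (0<1/p : 0ℚ < recip p 0<p) → recip (recip p 0<p) 0<1/p ≡ p
    recip-recip p 0<p _ = 1/-involutive p {{pos⇒nonZero p {{positive 0<p}}}}

    /-mono-≤ : ∀ a b c d → a ℕ.* suc d ℕ.≤ c ℕ.* suc b → + a / suc b ≤ + c / suc d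
    /-mono-≤ a b c d le = toℚᵘ-cancel-≤
      (ℚᵘ.≤-respˡ-≃ (ℚᵘ.≃-sym (toℚᵘ-fromℚᵘ (ℚᵘ.mkℚᵘ (+ a) b)))
        (ℚᵘ.≤-respʳ-≃ (ℚᵘ.≃-sym (toℚᵘ-fromℚᵘ (ℚᵘ.mkℚᵘ (+ c) d)))
          (ℚᵘ.*≤* (subst₂ ℤ._≤_ (ℤ.pos-* a (suc d)) (ℤ.pos-* c (suc b)) (ℤ.+≤+ le)))))
      where
      import Data.Rational.Unnormalised as ℚᵘ
      import Data.Rational.Unnormalised.Properties as ℚᵘ

    p≤∣p∣ : ∀ p → p ≤ ∣ p ∣
    p≤∣p∣ p with ≤-total 0ℚ p
    ... | inj₁ 0≤p = ≤-reflexive (sym (0≤p⇒∣p∣≡p 0≤p))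
    ... | inj₂ p≤0 = ≤-trans p≤0 (0≤∣p∣ p)

    -p≤∣p∣ : ∀ p → - p ≤ ∣ p ∣
    -p≤∣p∣ p = subst (- p ≤_) (∣-p∣≡∣p∣ p) (p≤∣p∣ (- p))

    ∣p∣≤q : p ≤ q → - p ≤ q → ∣ p ∣ ≤ q
    ∣p∣≤q {p} p≤q -p≤q with ∣p∣≡p∨∣p∣≡-p p
    ... | inj₁ eq = ≤-trans (≤-reflexive eq) p≤q
    ... | inj₂ eq = ≤-trans (≤-reflexive eq) -p≤q

    q≤p+q : 0ℚ ≤ p → ∀ q → q ≤ p + q
    q≤p+q {p} 0≤p q = subst (_≤ p + q) (+-identityˡ q) (+-monoˡ-≤ q 0≤p)

    p≤p+q : 0ℚ ≤ q → ∀ p → p ≤ p + q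
    p≤p+q {q} 0≤q p = subst (_≤ p + q) (+-identityʳ p) (+-monoʳ-≤ p 0≤q)

    0≤p+q : 0ℚ ≤ p → 0ℚ ≤ q → 0ℚ ≤ p + q
    0≤p+q {p} {q} 0≤p 0≤q = ≤-trans 0≤q (q≤p+q 0≤p q)

    <⊓ˡ : ∀ p q → r < p ⊓ q → r < p
    <⊓ˡ p q lt = <-≤-trans lt (p⊓q≤p p q)

    <⊓ʳ : ∀ p q → r < p ⊓ q → r < q
    <⊓ʳ p q lt = <-≤-trans lt (p⊓q≤q p q)

    <⊓ : ∀ p q → r < p → r < q → r < p ⊓ q
    <⊓ p q r<p r<q with ⊓-sel p q
    ... | inj₁ eq = subst (_ <_) (sym eq) r<p
    ... | inj₂ eq = subst (_ <_) (sym eq) r<q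

    ⊔<ˡ : ∀ p q → p ⊔ q < r → p < r
    ⊔<ˡ p q lt = ≤-<-trans (p≤p⊔q p q) lt

    ⊔<ʳ : ∀ p q → p ⊔ q < r → q < r
    ⊔<ʳ p q lt = ≤-<-trans (p≤q⊔p p q) lt

    ⊔< : ∀ p q → p < r → q < r → p ⊔ q < r
    ⊔< p q p<r q<r with ⊔-sel p q
    ... | inj₁ eq = subst (_< _) (sym eq) p<r
    ... | inj₂ eq = subst (_< _) (sym eq) q<r

    halve : 0ℚ < p → ∃[ h ] 0ℚ < h × h + h ≡ p
    halve {p} 0<p = ½ * p , subst (_< ½ * p) (*-zeroʳ ½) (*-monoʳ-<-0< ½ 0ℚ p (positive⁻¹ ½) 0<p) ,
      trans (sym (*-distribʳ-+ p ½ ½)) (*-identityˡ p)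

    quarter : p < q → ∃[ η ] 0ℚ < η × p + (η + η + (η + η)) ≡ q
    quarter {p} {q} p<q =
      let h , 0<h , h+h = halve (p<q⇒0<q-p p<q)
          η , 0<η , η+η = halve 0<h
      in η , 0<η , trans (cong (λ h → p + (h + h)) η+η)
           (trans (cong (λ z → p + z) h+h) (solve 2 (λ p q → p :+ (q :- p) := q) refl p q))

    precision : ∀ η K → 0ℚ < η → 0ℚ < K → ∃[ δ ] 0ℚ < δ × δ ≤ 1ℚ × δ * K ≤ η
    precision η K 0<η 0<K = 1ℚ ⊓ η/K , <⊓ 1ℚ η/K (positive⁻¹ 1ℚ) 0<η/K , p⊓q≤p 1ℚ η/K ,
      subst ((1ℚ ⊓ η/K) * K ≤_)
        (trans (*-assoc η _ K) (trans (cong (η *_) (trans (*-comm _ K) (*-recip K 0<K))) (*-identityʳ η)))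
        (*-monoˡ-≤-0≤ K (1ℚ ⊓ η/K) η/K (<⇒≤ 0<K) (p⊓q≤q 1ℚ η/K))
      where
      η/K : ℚ
      η/K = η * recip K 0<K
      0<η/K : 0ℚ < η/K
      0<η/K = subst (_< η/K) (*-zeroʳ η) (*-monoʳ-<-0< η 0ℚ (recip K 0<K) 0<η (recip-pos K 0<K))

    p<p+q : 0ℚ < q → ∀ p → p < p + q
    p<p+q {q} 0<q p = subst (_< p + q) (+-identityʳ p) (+-monoʳ-< p 0<q)

    times-/1 : ∀ n h → times n h ≡ (+ n / 1) * h
    times-/1 zero    h = sym (*-zeroˡ h)
    times-/1 (suc n) h = trans (cong (λ z → h + z) (times-/1 n h))
      (trans (solve 2 (λ h k → h :+ k :* h := (con 1ℚ :+ k) :* h) refl h (+ n / 1))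
             (cong (_* h) (sym (suc-/1 n))))
      where
      suc-/1 : ∀ n → + suc n / 1 ≡ 1ℚ + (+ n / 1)
      suc-/1 n = toℚᵘ-injective (ℚᵘ-lemma n)
        where
        import Data.Rational.Unnormalised as ℚᵘ
        import Data.Rational.Unnormalised.Properties as ℚᵘ
        ℚᵘ-lemma : ∀ n → toℚᵘ (+ suc n / 1) ℚᵘ.≃ toℚᵘ (1ℚ + (+ n / 1))
        ℚᵘ-lemma n =
          ℚᵘ.≃-trans (toℚᵘ-fromℚᵘ (ℚᵘ.mkℚᵘ (+ suc n) 0))
          (ℚᵘ.≃-trans (ℚᵘ.*≡* (cong (λ k → (+ 1 ℤ.+ k) ℤ.* + 1) (sym (ℤ.*-identityʳ (+ n)))))
          (ℚᵘ.≃-sym (ℚᵘ.≃-trans (toℚᵘ-homo-+ 1ℚ (+ n / 1))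
            (ℚᵘ.+-congʳ ℚᵘ.1ℚᵘ (toℚᵘ-fromℚᵘ (ℚᵘ.mkℚᵘ (+ n) 0))))))

    archimedean : ∀ q h → 0ℚ < h → ∃[ n ] q ≤ times n h
    archimedean q h 0<h = n , subst₂ _≤_ lhs (sym (times-/1 n h)) (*-monoˡ-≤-0≤ h t (+ n / 1) (<⇒≤ 0<h) t≤n)
      where
      t : ℚ
      t = q * recip h 0<h
      n : ℕ
      n = ℤ.∣ ↥ t ∣

      bound : ∀ i (d : ℕ) → i ℤ.* + 1 ℤ.≤ + ℤ.∣ i ∣ ℤ.* + suc d
      bound (+ m)      d = subst₂ ℤ._≤_ (ℤ.pos-* m 1) (ℤ.pos-* m (suc d))
                             (ℤ.+≤+ (ℕ.*-monoʳ-≤ m (ℕ.s≤s ℕ.z≤n)))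
      bound ℤ.-[1+ m ] d = ℤ.-≤+

      t≤n : t ≤ + n / 1
      t≤n = toℚᵘ-cancel-≤ (ℚᵘ.≤-respʳ-≃ (ℚᵘ.≃-sym (toℚᵘ-fromℚᵘ (ℚᵘ.mkℚᵘ (+ n) 0)))
              (ℚᵘ.*≤* (≤-lemma t)))
        where
        import Data.Rational.Unnormalised as ℚᵘ
        import Data.Rational.Unnormalised.Properties as ℚᵘ
        ≤-lemma : ∀ t → ℚᵘ.↥ (toℚᵘ t) ℤ.* + 1 ℤ.≤ + ℤ.∣ ↥ t ∣ ℤ.* ℚᵘ.↧ (toℚᵘ t)
        ≤-lemma (mkℚ i d _) = bound i d

      lhs : t * h ≡ q
      lhs = trans (*-assoc q _ h)
        (trans (cong (q *_) (trans (*-comm _ h) (*-recip h 0<h))) (*-identityʳ q))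

open ℚ-Lemmas

-- Two-sided Dedekind cuts: Lower x q means q < x, and Upper x q means x < q.
record ℝ : Set₁ where
  field
    Lower Upper : ℚ → Set
    lower-inhabited : ∃ Lower
    upper-inhabited : ∃ Upper
    lower-closed : p < q → Lower q → Lower p
    upper-closed : p < q → Upper p → Upper q
    lower-open   : Lower p → ∃[ q ] p < q × Lower q
    upper-open   : Upper q → ∃[ p ] p < q × Upper p
    lower<upper  : Lower p → Upper q → p < q
    located      : p < q → Lower p ⊎ Upper q

open ℝ public

infix  4 _≤ℝ_ _<ℝ_ _≃ℝ_
infix  8 -ℝ_ √_
infix  8 _⁻¹⟨_⟩
infixl 6 _+ℝ_ _-ℝ_ _⊔ℝ_
infixl 7 _*ℝ_ _÷_⟨_⟩

_≤ℝ_ : ℝ → ℝ → Set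
x ≤ℝ y = ∀ q → Lower x q → Lower y q

_<ℝ_ : ℝ → ℝ → Set
x <ℝ y = ∃[ q ] Upper x q × Lower y q

_≃ℝ_ : ℝ → ℝ → Set
x ≃ℝ y = x ≤ℝ y × y ≤ℝ x

fromℚ : ℚ → ℝ
fromℚ x = record
  { Lower = _< x
  ; Upper = x <_
  ; lower-inhabited = x - 1ℚ , p-1<p x
  ; upper-inhabited = x + 1ℚ , p<p+1 x
  ; lower-closed = <-trans
  ; upper-closed = λ p<q x<p → <-trans x<p p<q
  ; lower-open = λ p<x → let q , p<q , q<x = <-dense p<x in q , p<q , q<x
  ; upper-open = λ x<q → let p , x<p , p<q = <-dense x<q in p , p<q , x<p
  ; lower<upper = <-trans
  ; located = loc
  }
  where
  loc : p < q → p < x ⊎ x < q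
  loc {p} p<q with p <? x
  ... | yes p<x = inj₁ p<x
  ... | no  p≮x = inj₂ (≤-<-trans (≮⇒≥ p≮x) p<q)

fromℤ : ℤ → ℝ
fromℤ k = fromℚ (k / 1)

fromℕ : ℕ → ℝ
fromℕ n = fromℤ (+ n)

0ℝ : ℝ
0ℝ = fromℚ 0ℚ

-ℝ_ : ℝ → ℝ
-ℝ x = record
  { Lower = λ q → Upper x (- q)
  ; Upper = λ q → Lower x (- q)
  ; lower-inhabited = let u , U = upper-inhabited x in - u , subst (Upper x) (sym (neg-neg u)) U
  ; upper-inhabited = let l , L = lower-inhabited x in - l , subst (Lower x) (sym (neg-neg l)) L
  ; lower-closed = λ p<q → upper-closed x (neg-antimono-< p<q)
  ; upper-closed = λ p<q → lower-closed x (neg-antimono-< p<q)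
  ; lower-open = λ U → let r , r<-p , U′ = upper-open x U in
      - r , p<-q⇒q<-p r<-p , subst (Upper x) (sym (neg-neg r)) U′
  ; upper-open = λ L → let r , -q<r , L′ = lower-open x L in
      - r , -p<q⇒-q<p -q<r , subst (Lower x) (sym (neg-neg r)) L′
  ; lower<upper = λ {p} {q} U L → subst₂ _<_ (neg-neg p) (neg-neg q)
      (neg-antimono-< (lower<upper x L U))
  ; located = λ p<q → swap (located x (neg-antimono-< p<q))
  }

_⊔ℝ_ : ℝ → ℝ → ℝ
x ⊔ℝ y = record
  { Lower = λ q → Lower x q ⊎ Lower y q
  ; Upper = λ q → Upper x q × Upper y q
  ; lower-inhabited = let l , L = lower-inhabited x in l , inj₁ L
  ; upper-inhabited = ub
  ; lower-closed = λ p<q → ⊎.map (lower-closed x p<q) (lower-closed y p<q)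
  ; upper-closed = λ p<q → ×.map (upper-closed x p<q) (upper-closed y p<q)
  ; lower-open = λ
      { (inj₁ L) → let q , p<q , L′ = lower-open x L in q , p<q , inj₁ L′
      ; (inj₂ L) → let q , p<q , L′ = lower-open y L in q , p<q , inj₂ L′ }
  ; upper-open = uopen
  ; lower<upper = λ
      { (inj₁ L) (U , _) → lower<upper x L U
      ; (inj₂ L) (_ , U) → lower<upper y L U }
  ; located = loc
  }
  where
  ub : ∃[ q ] Upper x q × Upper y q
  ub =
    let u , U = upper-inhabited x
        v , V = upper-inhabited y
    in (u ⊔ v) + 1ℚ , upper-closed x (≤-<-trans (p≤p⊔q u v) (p<p+1 _)) U
                    , upper-closed y (≤-<-trans (p≤q⊔p u v) (p<p+1 _)) V
  uopen : Upper x q × Upper y q → ∃[ p ] p < q × Upper x p × Upper y p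
  uopen (U , V) =
    let u , u<q , U′ = upper-open x U
        v , v<q , V′ = upper-open y V
        p , m<p , p<q = <-dense (⊔< u v u<q v<q)
    in p , p<q , upper-closed x (⊔<ˡ u v m<p) U′ , upper-closed y (⊔<ʳ u v m<p) V′
  loc : p < q → (Lower x p ⊎ Lower y p) ⊎ (Upper x q × Upper y q)
  loc p<q with located x p<q | located y p<q
  ... | inj₁ L | _      = inj₁ (inj₁ L)
  ... | inj₂ _ | inj₁ L = inj₁ (inj₂ L)
  ... | inj₂ U | inj₂ V = inj₂ (U , V)

∣_∣ℝ : ℝ → ℝ
∣ x ∣ℝ = x ⊔ℝ (-ℝ x)

approximate : ∀ x δ → 0ℚ < δ → ∃[ a ] Lower x a × Upper x (a + δ)
approximate x δ 0<δ =
  let h , 0<h , h+h = halve 0<δ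
      a , L = lower-inhabited x
      b , U = upper-inhabited x
      n , b-a≤nh = archimedean (b - a) h 0<h
      b≤a+nh = ≤-trans (q-r≤p⇒q≤p+r (times n h) b a b-a≤nh) (≤-reflexive (+-comm _ a))
  in walk h 0<h h+h n a L (upper-≤ b≤a+nh U)
  where
  upper-≤ : p ≤ q → Upper x p → Upper x q
  upper-≤ p≤q U = let r , r<p , U′ = upper-open x U in upper-closed x (<-≤-trans r<p p≤q) U′
  walk : ∀ h → 0ℚ < h → h + h ≡ δ → ∀ n a → Lower x a → Upper x (a + times n h) →
    ∃[ a ] Lower x a × Upper x (a + δ)
  walk h 0<h h+h zero    a L U =
    a , L , upper-closed x (subst (_< a + δ) (sym (+-identityʳ a)) (p<p+q 0<δ a)) U
  walk h 0<h h+h (suc n) a L U with located x (p<p+q 0<h (a + h))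
  ... | inj₁ L′ = walk h 0<h h+h n (a + h) L′ (subst (Upper x) (sym (+-assoc a h _)) U)
  ... | inj₂ U′ = a , L , subst (Upper x) (trans (+-assoc a h h) (cong (λ z → a + z) h+h)) U′

_+ℝ_ : ℝ → ℝ → ℝ
x +ℝ y = record
  { Lower = λ q → ∃[ a ] ∃[ b ] Lower x a × Lower y b × q < a + b
  ; Upper = λ q → ∃[ a ] ∃[ b ] Upper x a × Upper y b × a + b < q
  ; lower-inhabited =
      let a , A = lower-inhabited x
          b , B = lower-inhabited y
      in (a + b) - 1ℚ , a , b , A , B , p-1<p _
  ; upper-inhabited =
      let a , A = upper-inhabited x
          b , B = upper-inhabited y
      in (a + b) + 1ℚ , a , b , A , B , p<p+1 _
  ; lower-closed = λ { p<q (a , b , A , B , lt) → a , b , A , B , <-trans p<q lt }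
  ; upper-closed = λ { p<q (a , b , A , B , lt) → a , b , A , B , <-trans lt p<q }
  ; lower-open = λ { (a , b , A , B , lt) →
      let q , p<q , q<a+b = <-dense lt in q , p<q , a , b , A , B , q<a+b }
  ; upper-open = λ { (a , b , A , B , lt) →
      let p , a+b<p , p<q = <-dense lt in p , p<q , a , b , A , B , a+b<p }
  ; lower<upper = λ { (a , b , A , B , lt) (a′ , b′ , A′ , B′ , lt′) →
      <-trans lt (<-trans (+-mono-< (lower<upper x A A′) (lower<upper y B B′)) lt′) }
  ; located = loc
  }
  where
  loc : p < q → (∃[ a ] ∃[ b ] Lower x a × Lower y b × p < a + b)
              ⊎ (∃[ a ] ∃[ b ] Upper x a × Upper y b × a + b < q)
  loc {p} p<q with quarter p<q
  ... | η , 0<η , p+4η≡q with approximate x η 0<η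
  ... | a , A , A′ with located y (p<p+q 0<η ((p + η) - a))
  ... | inj₁ B = inj₁ (a , (p + η) - a , A , B ,
        subst (p <_) (solve 3 (λ p a η → p :+ η := a :+ ((p :+ η) :- a)) refl p a η) (p<p+q 0<η p))
  ... | inj₂ B = inj₂ (a + η , ((p + η) - a) + η , A′ , B ,
        subst₂ _<_
          (solve 3 (λ p a η → p :+ η :+ (η :+ η) := (a :+ η) :+ (((p :+ η) :- a) :+ η)) refl p a η)
          (trans (solve 2 (λ p η → (p :+ η :+ (η :+ η)) :+ η := p :+ (η :+ η :+ (η :+ η))) refl p η) p+4η≡q)
          (p<p+q 0<η (p + η + (η + η))))

_-ℝ_ : ℝ → ℝ → ℝ
x -ℝ y = x +ℝ (-ℝ y)

record Enclosure (x : ℝ) : Set where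
  constructor enclosure
  field
    {lo hi} : ℚ
    lo∈ : Lower x lo
    hi∈ : Upper x hi

open Enclosure

minProduct maxProduct : ∀ {x y} → Enclosure x → Enclosure y → ℚ
minProduct I J = ((lo I * lo J) ⊓ (lo I * hi J)) ⊓ ((hi I * lo J) ⊓ (hi I * hi J))
maxProduct I J = ((lo I * lo J) ⊔ (lo I * hi J)) ⊔ ((hi I * lo J) ⊔ (hi I * hi J))

module Product where

  linear-> : ∀ u {c v d} → c ≤ v → v ≤ d → q < u * c → q < u * d → q < u * v
  linear-> u {c} {v} {d} c≤v v≤d q<uc q<ud with ≤-total 0ℚ u
  ... | inj₁ 0≤u = <-≤-trans q<uc (*-monoʳ-≤-0≤ u c v 0≤u c≤v)
  ... | inj₂ u≤0 = <-≤-trans q<ud (*-monoˡ-≤-nonPos u {{nonPositive u≤0}} {v} {d} v≤d)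

  linear-< : ∀ u {c v d} → c ≤ v → v ≤ d → u * c < q → u * d < q → u * v < q
  linear-< u {c} {v} {d} c≤v v≤d uc<q ud<q with ≤-total 0ℚ u
  ... | inj₁ 0≤u = ≤-<-trans (*-monoʳ-≤-0≤ u v d 0≤u v≤d) ud<q
  ... | inj₂ u≤0 = ≤-<-trans (*-monoˡ-≤-nonPos u {{nonPositive u≤0}} {c} {v} c≤v) uc<q

  module _ {x y : ℝ} where

    bilinear-> : ∀ (I : Enclosure x) (J : Enclosure y) {u v} →
      lo I ≤ u → u ≤ hi I → lo J ≤ v → v ≤ hi J → q < minProduct I J → q < u * v
    bilinear-> I J {u} {v} a≤u u≤b c≤v v≤d lt =
      linear-> u {lo J} {v} {hi J} c≤v v≤d
        (swap* (lo J) u (linear-> (lo J) {lo I} {u} {hi I} a≤u u≤b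
          (swap* (lo I) (lo J) (<⊓ˡ ac ad acd)) (swap* (hi I) (lo J) (<⊓ˡ bc bd bcd))))
        (swap* (hi J) u (linear-> (hi J) {lo I} {u} {hi I} a≤u u≤b
          (swap* (lo I) (hi J) (<⊓ʳ ac ad acd)) (swap* (hi I) (hi J) (<⊓ʳ bc bd bcd))))
      where
      ac = lo I * lo J
      ad = lo I * hi J
      bc = hi I * lo J
      bd = hi I * hi J
      acd = <⊓ˡ (ac ⊓ ad) (bc ⊓ bd) lt
      bcd = <⊓ʳ (ac ⊓ ad) (bc ⊓ bd) lt
      swap* : ∀ u v → q < u * v → q < v * u
      swap* u v = subst (_ <_) (*-comm u v)

    bilinear-< : ∀ (I : Enclosure x) (J : Enclosure y) {u v} →
      lo I ≤ u → u ≤ hi I → lo J ≤ v → v ≤ hi J → maxProduct I J < q → u * v < q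
    bilinear-< I J {u} {v} a≤u u≤b c≤v v≤d lt =
      linear-< u {lo J} {v} {hi J} c≤v v≤d
        (swap* (lo J) u (linear-< (lo J) {lo I} {u} {hi I} a≤u u≤b
          (swap* (lo I) (lo J) (⊔<ˡ ac ad acd)) (swap* (hi I) (lo J) (⊔<ˡ bc bd bcd))))
        (swap* (hi J) u (linear-< (hi J) {lo I} {u} {hi I} a≤u u≤b
          (swap* (lo I) (hi J) (⊔<ʳ ac ad acd)) (swap* (hi I) (hi J) (⊔<ʳ bc bd bcd))))
      where
      ac = lo I * lo J
      ad = lo I * hi J
      bc = hi I * lo J
      bd = hi I * hi J
      acd = ⊔<ˡ (ac ⊔ ad) (bc ⊔ bd) lt
      bcd = ⊔<ʳ (ac ⊔ ad) (bc ⊔ bd) lt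
      swap* : ∀ u v → u * v < q → v * u < q
      swap* u v = subst (_< _) (*-comm u v)

  lower-⊔ : ∀ x → Lower x p → Lower x q → Lower x (p ⊔ q)
  lower-⊔ {p} {q} x P Q with ⊔-sel p q
  ... | inj₁ eq = subst (Lower x) (sym eq) P
  ... | inj₂ eq = subst (Lower x) (sym eq) Q

  bounded : ∀ x δ → 0ℚ < δ → δ ≤ 1ℚ → ∀ {l u a} → Lower x l → Upper x u →
    Lower x a → Upper x (a + δ) → ∣ a ∣ ≤ (∣ l ∣ + ∣ u ∣) + 1ℚ
  bounded x δ 0<δ δ≤1 {l} {u} {a} L U A A′ = ∣p∣≤q
    (≤-trans (<⇒≤ (lower<upper x A U)) (≤-trans (p≤∣p∣ u)
      (≤-trans (q≤p+q (0≤∣p∣ l) ∣ u ∣) (p≤p+q (<⇒≤ (positive⁻¹ 1ℚ)) _))))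
    (≤-trans -a≤δ-l (≤-trans (+-mono-≤ δ≤1 (-p≤∣p∣ l))
      (subst (_≤ (∣ l ∣ + ∣ u ∣) + 1ℚ) (+-comm ∣ l ∣ 1ℚ)
        (+-monoˡ-≤ 1ℚ (p≤p+q (0≤∣p∣ u) ∣ l ∣)))))
    where
    -a≤δ-l : - a ≤ δ - l
    -a≤δ-l = subst₂ _≤_
      (solve 3 (λ l a δ → l :+ (:- l :- a) := :- a) refl l a δ)
      (solve 3 (λ l a δ → (a :+ δ) :+ (:- l :- a) := δ :- l) refl l a δ)
      (+-monoˡ-≤ (- l - a) (<⇒≤ (lower<upper x L A′)))

  near : ∀ {a c δ A C} → 0ℚ ≤ δ → δ ≤ 1ℚ → ∣ a ∣ ≤ A → ∣ c ∣ ≤ C → ∀ {s t} →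
    ∣ s ∣ ≤ δ → ∣ t ∣ ≤ δ → ∣ (a + s) * (c + t) - a * c ∣ ≤ δ * ((A + C) + 1ℚ)
  near {a} {c} {δ} {A} {C} 0≤δ δ≤1 ∣a∣≤A ∣c∣≤C {s} {t} ∣s∣≤δ ∣t∣≤δ =
    subst₂ _≤_
      (cong ∣_∣ (solve 4 (λ a c s t →
        (a :* t :+ s :* c) :+ s :* t := (a :+ s) :* (c :+ t) :- a :* c) refl a c s t))
      (solve 3 (λ A C δ → (A :* δ :+ δ :* C) :+ δ :* con 1ℚ := δ :* ((A :+ C) :+ con 1ℚ)) refl A C δ)
      (≤-trans (∣p+q∣≤∣p∣+∣q∣ (a * t + s * c) (s * t))
        (+-mono-≤
          (≤-trans (∣p+q∣≤∣p∣+∣q∣ (a * t) (s * c)) (+-mono-≤ (prod a t ∣a∣≤A ∣t∣≤δ) (prod s c ∣s∣≤δ ∣c∣≤C)))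
          (prod s t ∣s∣≤δ (≤-trans ∣t∣≤δ δ≤1))))
    where
    prod : ∀ u v {U V} → ∣ u ∣ ≤ U → ∣ v ∣ ≤ V → ∣ u * v ∣ ≤ U * V
    prod u v {U} {V} u≤ v≤ = subst (_≤ U * V) (sym (∣p*q∣≡∣p∣*∣q∣ u v))
      (≤-trans (*-monoˡ-≤-0≤ ∣ v ∣ ∣ u ∣ U (0≤∣p∣ v) u≤) (*-monoʳ-≤-0≤ U ∣ v ∣ V (≤-trans (0≤∣p∣ u) u≤) v≤))

  hull : (x : ℝ) → Enclosure x
  hull x = enclosure (proj₂ (lower-inhabited x)) (proj₂ (upper-inhabited x))

  spread : ℝ → ℚ
  spread x = (∣ lo (hull x) ∣ + ∣ hi (hull x) ∣) + 1ℚ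

  0≤spread : ∀ x → 0ℚ ≤ spread x
  0≤spread x = 0≤p+q (0≤p+q (0≤∣p∣ (lo (hull x))) (0≤∣p∣ (hi (hull x)))) (<⇒≤ (positive⁻¹ 1ℚ))

  module _ (x y : ℝ) where

    ProductLower ProductUpper : ℚ → Set
    ProductLower q = ∃[ I ] ∃[ J ] q < minProduct {x} {y} I J
    ProductUpper q = ∃[ I ] ∃[ J ] maxProduct {x} {y} I J < q

    lower<upper-* : ProductLower p → ProductUpper q → p < q
    lower<upper-* (I , J , lt) (I′ , J′ , lt′) = <-trans
      (bilinear-> I J (p≤p⊔q a a′) (<⇒≤ (lower<upper x u∈ (hi∈ I)))
                      (p≤p⊔q c c′) (<⇒≤ (lower<upper y v∈ (hi∈ J))) lt)
      (bilinear-< I′ J′ (p≤q⊔p a a′) (<⇒≤ (lower<upper x u∈ (hi∈ I′)))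
                        (p≤q⊔p c c′) (<⇒≤ (lower<upper y v∈ (hi∈ J′))) lt′)
      where
      a a′ c c′ : ℚ
      a = lo I
      a′ = lo I′
      c = lo J
      c′ = lo J′
      u∈ : Lower x (a ⊔ a′)
      u∈ = lower-⊔ x (lo∈ I) (lo∈ I′)
      v∈ : Lower y (c ⊔ c′)
      v∈ = lower-⊔ y (lo∈ J) (lo∈ J′)

    split-at : ∀ η → 0ℚ < η → p + (η + η + (η + η)) ≡ q →
      ∀ a c δ {A C} → 0ℚ < δ → δ ≤ 1ℚ → δ * ((A + C) + 1ℚ) ≤ η → ∣ a ∣ ≤ A → ∣ c ∣ ≤ C →
      Lower x a → Upper x (a + δ) → Lower y c → Upper y (c + δ) → ProductLower p ⊎ ProductUpper q
    split-at {p} {q} η 0<η p+4η≡q a c δ {A} {C} 0<δ δ≤1 δK≤η ∣a∣≤A ∣c∣≤C a∈ b∈ c∈ d∈ = split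
        where
        I : Enclosure x
        I = enclosure {x} {a} {a + δ} a∈ b∈
        J : Enclosure y
        J = enclosure {y} {c} {c + δ} c∈ d∈
        ∣0∣≤δ : ∣ 0ℚ ∣ ≤ δ
        ∣0∣≤δ = <⇒≤ 0<δ
        ∣δ∣≤δ : ∣ δ ∣ ≤ δ
        ∣δ∣≤δ = ≤-reflexive (0≤p⇒∣p∣≡p (<⇒≤ 0<δ))
        close : ∀ s t → ∣ s ∣ ≤ δ → ∣ t ∣ ≤ δ → ∣ (a + s) * (c + t) - a * c ∣ ≤ η
        close s t hs ht = ≤-trans (near {a} {c} {δ} {A} {C} (<⇒≤ 0<δ) δ≤1 ∣a∣≤A ∣c∣≤C {s} {t} hs ht) δK≤η
        above : ∀ m z → ∣ z - m ∣ ≤ η → p + η < m → p < z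
        above m z h lt = <-≤-trans
          (subst (_< m - η) (solve 2 (λ p η → (p :+ η) :- η := p) refl p η) (+-monoˡ-< (- η) lt))
          (subst₂ _≤_ (solve 3 (λ m z η → (m :- z) :+ (z :- η) := m :- η) refl m z η)
                      (solve 3 (λ m z η → η :+ (z :- η) := z) refl m z η)
            (+-monoˡ-≤ (z - η) (≤-trans
              (subst (_≤ ∣ z - m ∣) (solve 2 (λ m z → :- (z :- m) := m :- z) refl m z) (-p≤∣p∣ (z - m))) h)))
        below : ∀ m z → ∣ z - m ∣ ≤ η → m ≤ p + η → z < q
        below m z h le = ≤-<-trans
          (≤-trans
            (subst (_≤ m + η) (solve 2 (λ m z → m :+ (z :- m) := z) refl m z)
              (+-monoʳ-≤ m (≤-trans (p≤∣p∣ (z - m)) h)))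
            (+-monoˡ-≤ η le))
          (subst (p + η + η <_)
            (trans (solve 2 (λ p η → (p :+ η :+ η) :+ (η :+ η) := p :+ (η :+ η :+ (η :+ η))) refl p η) p+4η≡q)
            (p<p+q (+-mono-< 0<η 0<η) (p + η + η)))
        ac : ∣ a * c - a * c ∣ ≤ η
        ac = subst (λ z → ∣ z - a * c ∣ ≤ η) (cong₂ _*_ (+-identityʳ a) (+-identityʳ c)) (close 0ℚ 0ℚ ∣0∣≤δ ∣0∣≤δ)
        ad : ∣ a * (c + δ) - a * c ∣ ≤ η
        ad = subst (λ z → ∣ z * (c + δ) - a * c ∣ ≤ η) (+-identityʳ a) (close 0ℚ δ ∣0∣≤δ ∣δ∣≤δ)
        bc : ∣ (a + δ) * c - a * c ∣ ≤ η
        bc = subst (λ z → ∣ (a + δ) * z - a * c ∣ ≤ η) (+-identityʳ c) (close δ 0ℚ ∣δ∣≤δ ∣0∣≤δ)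
        bd : ∣ (a + δ) * (c + δ) - a * c ∣ ≤ η
        bd = close δ δ ∣δ∣≤δ ∣δ∣≤δ
        m n₁ n₂ n₃ : ℚ
        m = a * c
        n₁ = a * (c + δ)
        n₂ = (a + δ) * c
        n₃ = (a + δ) * (c + δ)
        split : ProductLower p ⊎ ProductUpper q
        split with (p + η) <? m
        ... | yes lt = inj₁ (I , J ,
              <⊓ (m ⊓ n₁) (n₂ ⊓ n₃) (<⊓ m n₁ (above m m ac lt) (above m n₁ ad lt))
                                    (<⊓ n₂ n₃ (above m n₂ bc lt) (above m n₃ bd lt)))
        ... | no ≮ = inj₂ (I , J ,
              ⊔< (m ⊔ n₁) (n₂ ⊔ n₃) (⊔< m n₁ (below m m ac le) (below m n₁ ad le))
                                    (⊔< n₂ n₃ (below m n₂ bc le) (below m n₃ bd le)))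
          where
          le : m ≤ p + η
          le = ≮⇒≥ ≮

    located-* : p < q → ProductLower p ⊎ ProductUpper q
    located-* p<q =
      let η , 0<η , p+4η≡q = quarter p<q
          lx = lo∈ (hull x)
          ux = hi∈ (hull x)
          ly = lo∈ (hull y)
          uy = hi∈ (hull y)
          δ , 0<δ , δ≤1 , δK≤η = precision η (((spread x) + (spread y)) + 1ℚ) 0<η
            (≤-<-trans (0≤p+q (0≤spread x) (0≤spread y)) (p<p+1 _))
          a , a∈ , b∈ = approximate x δ 0<δ
          c , c∈ , d∈ = approximate y δ 0<δ
      in split-at η 0<η p+4η≡q a c δ 0<δ δ≤1 δK≤η
           (bounded x δ 0<δ δ≤1 lx ux a∈ b∈) (bounded y δ 0<δ δ≤1 ly uy c∈ d∈) a∈ b∈ c∈ d∈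

-- Interval multiplication: if x ∈ (a, b) and y ∈ (c, d), then x y lies between the extremes
-- of a c, a d, b c, b d.
_*ℝ_ : ℝ → ℝ → ℝ
x *ℝ y = record
  { Lower = λ q → ∃[ I ] ∃[ J ] q < minProduct {x} {y} I J
  ; Upper = λ q → ∃[ I ] ∃[ J ] maxProduct {x} {y} I J < q
  ; lower-inhabited = minProduct (hull x) (hull y) - 1ℚ , hull x , hull y , p-1<p _
  ; upper-inhabited = maxProduct (hull x) (hull y) + 1ℚ , hull x , hull y , p<p+1 _
  ; lower-closed = λ { p<q (I , J , lt) → I , J , <-trans p<q lt }
  ; upper-closed = λ { p<q (I , J , lt) → I , J , <-trans lt p<q }
  ; lower-open = λ { (I , J , lt) → let q , p<q , lt′ = <-dense lt in q , p<q , I , J , lt′ }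
  ; upper-open = λ { (I , J , lt) → let p , lt′ , p<q = <-dense lt in p , p<q , I , J , lt′ }
  ; lower<upper = lower<upper-* x y
  ; located = located-* x y
  }
  where open Product

_⁻¹⟨_⟩ : (x : ℝ) → 0ℝ <ℝ x → ℝ
x ⁻¹⟨ p , 0<p , P ⟩ = record
  { Lower = λ q → ∃[ b ] Σ[ 0<b ∈ 0ℚ < b ] Upper x b × q < recip b 0<b
  ; Upper = λ q → ∃[ a ] Σ[ 0<a ∈ 0ℚ < a ] Lower x a × recip a 0<a < q
  ; lower-inhabited = let b , U = upper-inhabited x in 0ℚ , b , above-0 U , U , recip-pos b (above-0 U)
  ; upper-inhabited = recip p 0<p + 1ℚ , p , 0<p , P , p<p+1 _
  ; lower-closed = λ { p<q (b , 0<b , U , lt) → b , 0<b , U , <-trans p<q lt }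
  ; upper-closed = λ { p<q (a , 0<a , L , lt) → a , 0<a , L , <-trans lt p<q }
  ; lower-open = λ { (b , 0<b , U , lt) →
      let q , p<q , lt′ = <-dense lt in q , p<q , b , 0<b , U , lt′ }
  ; upper-open = λ { (a , 0<a , L , lt) →
      let p , lt′ , p<q = <-dense lt in p , p<q , a , 0<a , L , lt′ }
  ; lower<upper = λ { (b , 0<b , U , q<1/b) (a , 0<a , L , 1/a<r) →
      <-trans q<1/b (<-trans (recip-anti-< 0<a 0<b (lower<upper x L U)) 1/a<r) }
  ; located = loc
  }
  where
  above-0 : ∀ {b} → Upper x b → 0ℚ < b
  above-0 U = <-trans 0<p (lower<upper x P U)
  loc : q < r → (∃[ b ] Σ[ 0<b ∈ 0ℚ < b ] Upper x b × q < recip b 0<b)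
              ⊎ (∃[ a ] Σ[ 0<a ∈ 0ℚ < a ] Lower x a × recip a 0<a < r)
  loc {q} {r} q<r with 0ℚ <? q
  ... | no q≤0 = let b , U = upper-inhabited x in
        inj₁ (b , above-0 U , U , ≤-<-trans (≮⇒≥ q≤0) (recip-pos b (above-0 U)))
  ... | yes 0<q with located x (recip-anti-< 0<q (<-trans 0<q q<r) q<r)
  ... | inj₁ L = let a , 1/r<a , L′ = lower-open x L
                     0<r = <-trans 0<q q<r
                     0<1/r = recip-pos r 0<r
                     0<a = <-trans 0<1/r 1/r<a
                 in inj₂ (a , 0<a , L′ ,
                      subst (recip a 0<a <_) (recip-recip r 0<r 0<1/r) (recip-anti-< 0<1/r 0<a 1/r<a))
  ... | inj₂ U = let b , b<1/q , U′ = upper-open x U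
                     0<1/q = recip-pos q 0<q
                 in inj₁ (b , above-0 U′ , U′ ,
                      subst (_< recip b (above-0 U′)) (recip-recip q 0<q 0<1/q)
                        (recip-anti-< (above-0 U′) 0<1/q b<1/q))

_÷_⟨_⟩ : (x y : ℝ) → 0ℝ <ℝ y → ℝ
x ÷ y ⟨ 0<y ⟩ = x *ℝ y ⁻¹⟨ 0<y ⟩

-- Total: on negative arguments the value is 0ℝ.
√_ : ℝ → ℝ
√ x = record
  { Lower = λ q → ∃[ p ] q < p × (p ≤ 0ℚ ⊎ Lower x (p * p))
  ; Upper = λ q → ∃[ p ] p < q × (0ℚ ≤ p × Upper x (p * p))
  ; lower-inhabited = 0ℚ - 1ℚ , 0ℚ , p-1<p 0ℚ , inj₁ ≤-refl
  ; upper-inhabited = ub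
  ; lower-closed = λ { p<q (s , lt , h) → s , <-trans p<q lt , h }
  ; upper-closed = λ { p<q (s , lt , h) → s , <-trans lt p<q , h }
  ; lower-open = λ { (s , lt , h) → let q , p<q , lt′ = <-dense lt in q , p<q , s , lt′ , h }
  ; upper-open = λ { (s , lt , h) → let p , lt′ , p<q = <-dense lt in p , p<q , s , lt′ , h }
  ; lower<upper = λ
      { (s , q<s , inj₁ s≤0) (t , t<r , 0≤t , U) → <-trans q<s (≤-<-trans (≤-trans s≤0 0≤t) t<r)
      ; (s , q<s , inj₂ L)   (t , t<r , 0≤t , U) →
          <-trans q<s (<-trans (squares-< 0≤t (lower<upper x L U)) t<r) }
  ; located = loc
  }
  where
  ub : ∃[ q ] ∃[ p ] p < q × (0ℚ ≤ p × Upper x (p * p))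
  ub =
    let b , U = upper-inhabited x
        p = (b ⊔ 0ℚ) + 1ℚ
        1≤p = q≤p+q (p≤q⊔p b 0ℚ) 1ℚ
        0≤p = ≤-trans (<⇒≤ (positive⁻¹ 1ℚ)) 1≤p
        p≤p² = subst (_≤ p * p) (*-identityʳ p) (*-monoʳ-≤-0≤ p 1ℚ p 0≤p 1≤p)
    in p + 1ℚ , p , p<p+1 p , 0≤p ,
       upper-closed x (≤-<-trans (p≤p⊔q b 0ℚ) (<-≤-trans (p<p+1 (b ⊔ 0ℚ)) p≤p²)) U
  loc : q < r → (∃[ p ] q < p × (p ≤ 0ℚ ⊎ Lower x (p * p)))
              ⊎ (∃[ p ] p < r × (0ℚ ≤ p × Upper x (p * p)))
  loc q<r with <-dense q<r
  ... | m , q<m , m<r with 0ℚ <? m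
  ... | no m≤0 = inj₁ (m , q<m , inj₁ (≮⇒≥ m≤0))
  ... | yes 0<m with <-dense m<r
  ... | m′ , m<m′ , m′<r with located x (<-trans (*-monoˡ-<-0< m m m′ 0<m m<m′)
                                                 (*-monoʳ-<-0< m′ m m′ (<-trans 0<m m<m′) m<m′))
  ... | inj₁ L = inj₁ (m , q<m , inj₂ L)
  ... | inj₂ U = inj₂ (m′ , m′<r , <⇒≤ (<-trans 0<m m<m′) , U)

-- a / suc b ≤ log₂ n exactly when 2 ^ a ≤ n ^ suc b.  Numerators in ℕ suffice because
-- 0 ≤ log₂ n.
log₂ : (n : ℕ) .{{_ : ℕ.NonZero n}} → ℝ
log₂ n = record
  { Lower = λ q → ∃[ a ] ∃[ b ] q < + a / suc b × 2 ℕ.^ a ℕ.≤ n ℕ.^ suc b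
  ; Upper = λ q → ∃[ a ] ∃[ b ] + a / suc b < q × n ℕ.^ suc b ℕ.≤ 2 ℕ.^ a
  ; lower-inhabited = 0ℚ - 1ℚ , 0 , 0 , p-1<p 0ℚ , ℕ.m^n>0 n 1
  ; upper-inhabited = (+ n / 1) + 1ℚ , n , 0 , p<p+1 (+ n / 1) ,
      ℕ.≤-trans (ℕ.≤-reflexive (ℕ.^-identityʳ n)) (n≤2^n n)
  ; lower-closed = λ { p<q (a , b , lt , h) → a , b , <-trans p<q lt , h }
  ; upper-closed = λ { p<q (a , b , lt , h) → a , b , <-trans lt p<q , h }
  ; lower-open = λ { (a , b , lt , h) → let q , p<q , lt′ = <-dense lt in q , p<q , a , b , lt′ , h }
  ; upper-open = λ { (a , b , lt , h) → let p , lt′ , p<q = <-dense lt in p , p<q , a , b , lt′ , h }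
  ; lower<upper = λ { (a , b , lt , h) (c , d , lt′ , h′) →
      <-trans lt (≤-<-trans (/-mono-≤ a b c d (exponents a b c d h h′)) lt′) }
  ; located = loc
  }
  where
  n≤2^n : ∀ n → n ℕ.≤ 2 ℕ.^ n
  n≤2^n zero    = ℕ.z≤n
  n≤2^n (suc n) = ℕ.+-mono-≤ (ℕ.m^n>0 2 n)
    (ℕ.≤-trans (n≤2^n n) (ℕ.≤-reflexive (sym (ℕ.+-identityʳ (2 ℕ.^ n)))))

  exponents : ∀ a b c d → 2 ℕ.^ a ℕ.≤ n ℕ.^ suc b → n ℕ.^ suc d ℕ.≤ 2 ℕ.^ c →
    a ℕ.* suc d ℕ.≤ c ℕ.* suc b
  exponents a b c d h h′ = ℕ.≮⇒≥ λ lt → ℕ.<⇒≱ (ℕ.^-monoʳ-< 2 (ℕ.s≤s (ℕ.s≤s ℕ.z≤n)) lt)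
    (begin
      2 ℕ.^ (a ℕ.* suc d)         ≡⟨ ℕ.^-*-assoc 2 a (suc d) ⟨
      (2 ℕ.^ a) ℕ.^ suc d         ≤⟨ ℕ.^-monoˡ-≤ (suc d) h ⟩
      (n ℕ.^ suc b) ℕ.^ suc d     ≡⟨ ℕ.^-*-assoc n (suc b) (suc d) ⟩
      n ℕ.^ (suc b ℕ.* suc d)     ≡⟨ cong (n ℕ.^_) (ℕ.*-comm (suc b) (suc d)) ⟩
      n ℕ.^ (suc d ℕ.* suc b)     ≡⟨ ℕ.^-*-assoc n (suc d) (suc b) ⟨
      (n ℕ.^ suc d) ℕ.^ suc b     ≤⟨ ℕ.^-monoˡ-≤ (suc b) h′ ⟩
      (2 ℕ.^ c) ℕ.^ suc b         ≡⟨ ℕ.^-*-assoc 2 c (suc b) ⟩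
      2 ℕ.^ (c ℕ.* suc b)         ∎)
    where open ℕ.≤-Reasoning

  loc : q < r → (∃[ a ] ∃[ b ] q < + a / suc b × 2 ℕ.^ a ℕ.≤ n ℕ.^ suc b)
              ⊎ (∃[ a ] ∃[ b ] + a / suc b < r × n ℕ.^ suc b ℕ.≤ 2 ℕ.^ a)
  loc {q} {r} q<r with <-dense q<r
  ... | m@(mkℚ (+ a) b _) , q<m , m<r with ℕ.≤-total (2 ℕ.^ a) (n ℕ.^ suc b)
  ...   | inj₁ le = inj₁ (a , b , subst (q <_) (sym (↥p/↧p≡p m)) q<m , le)
  ...   | inj₂ le = inj₂ (a , b , subst (_< r) (sym (↥p/↧p≡p m)) m<r , le)
  loc q<r | m@(mkℚ ℤ.-[1+ _ ] _ _) , q<m , m<r =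
    inj₁ (0 , 0 , <-trans q<m (negative⁻¹ m) , ℕ.m^n>0 n 1)

0<log₂ : ∀ n .{{_ : ℕ.NonZero n}} → 2 ℕ.≤ n → 0ℝ <ℝ log₂ n
0<log₂ n 2≤n = ½ , positive⁻¹ ½ , 1 , 0 , ½<1 , ℕ.^-monoˡ-≤ 1 2≤n
  where
  ½<1 : ½ < 1ℚ
  ½<1 = *<* (ℤ.+<+ (ℕ.s≤s (ℕ.s≤s ℕ.z≤n)))

+ℝ-rawMonoid : RawMonoid (lsuc 0ℓ) 0ℓ
+ℝ-rawMonoid = record { Carrier = ℝ ; _≈_ = _≃ℝ_ ; _∙_ = _+ℝ_ ; ε = 0ℝ }

infixr 8 _·_

_·_ : ℕ → ℝ → ℝ
_·_ = multiple +ℝ-rawMonoid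

sumℝ : List ℝ → ℝ
sumℝ = foldr _+ℝ_ 0ℝ

-- Points of ℝ/ℤ are given by real representatives, compared by _≈𝕋_.
𝕋 : Set₁
𝕋 = ℝ

infix 4 _≈𝕋_ ∣_mod1∣≤_ ∥_mod1∥∞≤_

_≈𝕋_ : 𝕋 → 𝕋 → Set
z ≈𝕋 w = ∃[ k ] z -ℝ w ≃ℝ fromℤ k

-- w = ι z
record IsRepresentative (z : 𝕋) (w : ℝ) : Set where
  field
    congruent : z ≈𝕋 w
    -½≤w      : fromℚ (- ½) ≤ℝ w
    w<½       : w <ℝ fromℚ ½

-- ι is discontinuous, so it is a relation here rather than a function on 𝕋.
∣_mod1∣≤_ : 𝕋 → ℝ → Set₁
∣ z mod1∣≤ ε = ∃[ w ] IsRepresentative z w × ∣ w ∣ℝ ≤ℝ ε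

Cube : ℕ → Set
Cube = Vec Bool

bit : Bool → ℕ
bit b = if b then 1 else 0

weight : ∀ {n} → Cube n → ℕ
weight x = Vec.sum (Vec.map bit x)

Maj : ∀ n → Cube n → Bool
Maj n x = n ℕ.≤ᵇ 2 ℕ.* weight x

∥_mod1∥∞≤_ : ∀ {n} → (Cube n → 𝕋) → ℝ → Set₁
∥ F mod1∥∞≤ ε = ∀ x → ∣ F x mod1∣≤ ε

subsets : ∀ n → List (Subset n)
subsets zero    = Vec.[] ∷ []
subsets (suc n) = map (outside Vec.∷_) (subsets n) ++ map (inside Vec.∷_) (subsets n)

monomial : ∀ {n} → Subset n → Cube n → ℕ
monomial S x = product (tabulate λ i → if lookup S i then bit (lookup x i) else 1)

polynomial : ∀ {n} → ℕ → (Subset n → ℝ) → Cube n → ℝ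
polynomial {n} d coeff x =
  sumℝ (map (λ S → monomial S x · coeff S) (filter (λ S → size S ℕ.≤? d) (subsets n)))

IsSymmetricTorusPolynomial : ∀ {n} → ℕ → (Cube n → 𝕋) → Set₁
IsSymmetricTorusPolynomial d P = ∃[ coeff ]
  (∀ S T → size S ≡ size T → coeff S ≃ℝ coeff T) × (∀ x → P x ≈𝕋 polynomial d coeff x)

_Approximates_within_ : ∀ {n} → (Cube n → 𝕋) → (Cube n → Bool) → ℝ → Set₁
P Approximates f within ε = ∥ (λ x → P x -ℝ fromℚ (+ bit (f x) / 2)) mod1∥∞≤ ε

{-# OPTIONS --safe #-}

-- A symmetric polynomial of degree d on the cube is a polynomial p of degree d in |x|.
-- There are n^O(d²) possible vectors of binomial moments Σₖ uₖ C(k, j), j ≤ d, of a 0/1 vector u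
-- of length about n/2; if their number is below 2^(n/2), two such vectors u ≠ v have the same moments,
-- whence Σₖ (uₖ - vₖ) p(a + k) = 0 for every a.  Choose a so that the first k with uₖ ≠ vₖ falls on the
-- last weight at which Maj vanishes.  Since p is within O(1/n) of ½ Maj modulo 1, the sum
-- differs from ½ modulo 1 by less than ½, so it is not 0; hence n^(16 d²) > 2^n.  The real coefficients of p
-- enter only through rational approximations.
module Submission where

-- Distinct 0/1 vectors with equal binomial moments, by pigeonhole.

module Collision where

  open import Data.Fin using (Fin; zero; suc; toℕ; fromℕ<; combine; quotient; remainder; funToFin; finToFun)
  open import Data.Fin.Properties
    using (toℕ≤pred[n]; toℕ<n; toℕ-fromℕ<; combine-remQuot; finToFun-funToFin; pigeonhole; <⇒≢)
  open import Data.Fin.Patterns using (0F; 1F)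
  open import Data.Nat
  open import Data.Nat.Properties hiding (<⇒≢)
  open import Data.Product using (∃-syntax; _×_; _,_)
  open import Data.Vec using (Vec; []; _∷_)
  open import Data.Vec.Properties using (∷-injective)
  open import Function using (_∘_)
  open import Relation.Binary.PropositionalEquality
  open import Relation.Nullary using (contradiction)

  Selection : ℕ → Set
  Selection = Vec (Fin 2)

  -- moment u j = Σₖ uₖ C(k, j), computed from the tail by Pascal's rule.
  moment : ∀ {L} → Selection L → ℕ → ℕ
  moment []      _       = 0
  moment (b ∷ u) zero    = toℕ b + moment u 0
  moment (b ∷ u) (suc j) = moment u j + moment u (suc j)

  SameMoments : ∀ {K L} → ℕ → Selection K → Selection L → Set
  SameMoments D u v = ∀ j → j < D → moment u j ≡ moment v j

  -- For a tail of length `L` the two bounds joined by Pascal's rule add up to `suc L * L ^ suc j`.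
  -- The estimate is crude; only the growth of the exponent with `j` matters.
  moment≤ : ∀ {L} (u : Selection L) j → moment u j ≤ L ^ suc j
  moment≤ []      j       = z≤n
  moment≤ (b ∷ u) zero    = +-mono-≤ (toℕ≤pred[n] b) (moment≤ u 0)
  moment≤ {suc L} (b ∷ u) (suc j) = ≤-trans (+-mono-≤ (moment≤ u j) (moment≤ u (suc j)))
    (*-monoʳ-≤ (suc L) (^-monoˡ-≤ (suc j) (n≤1+n L)))

  decode : ∀ L → Fin (2 ^ L) → Selection L
  decode zero    i = []
  decode (suc L) i = quotient (2 ^ L) i ∷ decode L (remainder {2} (2 ^ L) i)

  decode-injective : ∀ L {i j} → decode L i ≡ decode L j → i ≡ j
  decode-injective zero    {0F} {0F} _ = refl
  decode-injective (suc L) {i} {j} eq with q≡ , r≡ ← ∷-injective eq =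
    trans (sym (combine-remQuot {2} (2 ^ L) i))
      (trans (cong₂ combine q≡ (decode-injective L r≡)) (combine-remQuot {2} (2 ^ L) j))

  -- A common range for all orders below `D` lets `funToFin` number the moment vectors by
  -- `suc (L ^ D) ^ D` codes.
  moments : ∀ D {L} .{{_ : NonZero L}} → Selection L → Fin D → Fin (suc (L ^ D))
  moments D {L} u j = fromℕ< (s≤s (≤-trans (moment≤ u (toℕ j)) (^-monoʳ-≤ L (toℕ<n j))))

  moments-injective : ∀ D {L} .{{_ : NonZero L}} {u v : Selection L} →
    funToFin (moments D u) ≡ funToFin (moments D v) → SameMoments D u v
  moments-injective D {L} {u} {v} eq j j<D =
    subst (λ j → moment u j ≡ moment v j) (toℕ-fromℕ< j<D) (begin
      moment u (toℕ k)                                ≡⟨ toℕ-fromℕ< _ ⟨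
      toℕ (moments D u k)                             ≡⟨ cong toℕ (finToFun-funToFin (moments D u) k) ⟨
      toℕ (finToFun (funToFin (moments D u)) k)       ≡⟨ cong (λ i → toℕ (finToFun i k)) eq ⟩
      toℕ (finToFun (funToFin (moments D v)) k)       ≡⟨ cong toℕ (finToFun-funToFin (moments D v) k) ⟩
      toℕ (moments D v k)                             ≡⟨ toℕ-fromℕ< _ ⟩
      moment v (toℕ k)                                ∎)
    where
    open ≡-Reasoning
    k : Fin D
    k = fromℕ< j<D

  collision : ∀ D L .{{_ : NonZero L}} → suc (L ^ D) ^ D < 2 ^ L →
    ∃[ u ] ∃[ v ] u ≢ v × SameMoments {L} D u v
  collision D L few
    with i , j , i<j , same ← pigeonhole few (λ i → funToFin (moments D (decode L i))) =
    decode L i , decode L j , (λ eq → <⇒≢ i<j (decode-injective L eq)) ,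
    moments-injective D {u = decode L i} {v = decode L j} same

  -- At order 0 both sides lose `toℕ b`. At order `suc j` Pascal's rule gives the sum of the tail's
  -- moments of orders `j` and `suc j`, so equality climbs from `j` to `suc j` by cancellation.
  SameMoments-tail : ∀ {D L} b {u v : Selection L} → SameMoments D (b ∷ u) (b ∷ v) → SameMoments D u v
  SameMoments-tail b same zero j<D = +-cancelˡ-≡ (toℕ b) _ _ (same 0 j<D)
  SameMoments-tail b {u} {v} same (suc j) j<D = +-cancelˡ-≡ (moment u j) _ _
    (trans (same (suc j) j<D)
      (cong (_+ moment v (suc j)) (sym (SameMoments-tail b {u} {v} same j (<-trans (n<1+n j) j<D)))))

  -- Removing an equal leading entry shifts every index by one but keeps the moments equal. At the
  -- first disagreement the vectors are swapped if necessary.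
  strip-common-prefix : ∀ {D L} (u v : Selection L) → u ≢ v → SameMoments D u v →
    ∃[ K ] K < L × ∃[ u′ ] ∃[ v′ ] SameMoments {suc K} {suc K} D (0F ∷ u′) (1F ∷ v′)
  strip-common-prefix []       []       u≢v same = contradiction refl u≢v
  strip-common-prefix (0F ∷ u) (1F ∷ v) u≢v same = _ , ≤-refl , u , v , same
  strip-common-prefix (1F ∷ u) (0F ∷ v) u≢v same = _ , ≤-refl , v , u , λ j j<D → sym (same j j<D)
  strip-common-prefix (0F ∷ u) (0F ∷ v) u≢v same
    with K , K<L , rest ← strip-common-prefix u v (u≢v ∘ cong (0F ∷_)) (SameMoments-tail 0F {u} {v} same) =
    K , m<n⇒m<1+n K<L , rest
  strip-common-prefix (1F ∷ u) (1F ∷ v) u≢v same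
    with K , K<L , rest ← strip-common-prefix u v (u≢v ∘ cong (1F ∷_)) (SameMoments-tail 1F {u} {v} same) =
    K , m<n⇒m<1+n K<L , rest

-- Polynomials in the binomial basis, and distance to the integers.

module Newton where

  open Collision
  open import Data.Fin using (zero; suc; toℕ)
  open import Data.Fin.Patterns using (0F; 1F)
  open import Data.Integer as ℤ using (ℤ)
  import Data.Integer.Properties as ℤ
  open import Data.Nat as ℕ using (ℕ; zero; suc; s≤s; z≤n)
  import Data.Nat.Properties as ℕ
  open import Data.Rational
  open import Data.Rational.Properties
  open import Algebra.Properties.CommutativeMonoid.Mult +-0-commutativeMonoid
  open import Data.Rational.Solver using (module +-*-Solver)
  open +-*-Solver using (solve; _:=_; con; _:+_; _:-_; :-_)
  open import Data.Vec using ([]; _∷_)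
  open import Function using (_∘_)
  open import Relation.Binary.PropositionalEquality
  open import Relation.Nullary using (yes; no)
  import Data.Rational.Unnormalised as ℚᵘ
  import Data.Rational.Unnormalised.Properties as ℚᵘ
  open import Defs
  open ℚ-Lemmas using (p≤∣p∣; -p≤∣p∣)

  -- The coefficients of p(k + 1) in the basis C(k, j), when `c` holds those of p.
  next : (ℕ → ℚ) → ℕ → ℚ
  next c j = c j + c (suc j)

  -- eval c k = Σⱼ c j C(k, j)
  eval : (ℕ → ℚ) → ℕ → ℚ
  eval c zero    = c 0
  eval c (suc k) = eval (next c) k

  -- Degree below `D`. The coefficients form an infinite sequence, and the degree is carried by this
  -- predicate, which `next` preserves.
  VanishesFrom : ℕ → (ℕ → ℚ) → Set
  VanishesFrom D c = ∀ j → D ℕ.≤ j → c j ≡ 0ℚ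

  next-vanishes : ∀ {D c} → VanishesFrom D c → VanishesFrom D (next c)
  next-vanishes c≡0 j D≤j = cong₂ _+_ (c≡0 j D≤j) (c≡0 (suc j) (ℕ.m≤n⇒m≤1+n D≤j))

  translate : ℕ → (ℕ → ℚ) → ℕ → ℚ
  translate zero    c = c
  translate (suc a) c = translate a (next c)

  eval-translate : ∀ a c k → eval (translate a c) k ≡ eval c (a ℕ.+ k)
  eval-translate zero    c k = refl
  eval-translate (suc a) c k = eval-translate a (next c) k

  translate-vanishes : ∀ a {D c} → VanishesFrom D c → VanishesFrom D (translate a c)
  translate-vanishes zero    c≡0 = c≡0
  translate-vanishes (suc a) c≡0 = translate-vanishes a (next-vanishes c≡0)

  select : ∀ {L} → Selection L → (ℕ → ℚ) → ℚ
  select []      f = 0ℚ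
  select (b ∷ u) f = toℕ b × f 0 + select u (f ∘ suc)

  select-cong : ∀ {L} (u : Selection L) {f g} → (∀ k → f k ≡ g k) → select u f ≡ select u g
  select-cong []      f≡g = refl
  select-cong (b ∷ u) f≡g = cong₂ _+_ (cong (toℕ b ×_) (f≡g 0)) (select-cong u (f≡g ∘ suc))

  interchange : ∀ a b c d → (a + b) + (c + d) ≡ (a + c) + (b + d)
  interchange = solve 4 (λ a b c d → (a :+ b) :+ (c :+ d) := (a :+ c) :+ (b :+ d)) refl

  select-+ : ∀ {L} (u : Selection L) f h →
    select u (λ k → f k + h) ≡ select u f + moment u 0 × h
  select-+ []      f h = refl
  select-+ (b ∷ u) f h = begin
    toℕ b × (f 0 + h) + select u (λ k → f (suc k) + h)
      ≡⟨ cong₂ _+_ (×-distrib-+ (f 0) h (toℕ b)) (select-+ u (f ∘ suc) h) ⟩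
    (toℕ b × f 0 + toℕ b × h) + (select u (f ∘ suc) + moment u 0 × h)
      ≡⟨ interchange (toℕ b × f 0) _ _ _ ⟩
    select (b ∷ u) f + (toℕ b × h + moment u 0 × h)
      ≡⟨ cong (_+_ (select (b ∷ u) f)) (×-homo-+ h (toℕ b) (moment u 0)) ⟨
    select (b ∷ u) f + moment (b ∷ u) 0 × h ∎
    where open ≡-Reasoning

  dot : ℕ → (ℕ → ℕ) → (ℕ → ℚ) → ℚ
  dot zero    M c = 0ℚ
  dot (suc D) M c = M 0 × c 0 + dot D (M ∘ suc) (c ∘ suc)

  dot-cong : ∀ D {M N} c → (∀ j → j ℕ.< D → M j ≡ N j) → dot D M c ≡ dot D N c
  dot-cong zero    c M≡N = refl
  dot-cong (suc D) c M≡N = cong₂ _+_ (cong (_× c 0) (M≡N 0 (s≤s z≤n)))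
    (dot-cong D (c ∘ suc) (λ j j<D → M≡N (suc j) (s≤s j<D)))

  dot-zero : ∀ D c → dot D (λ _ → 0) c ≡ 0ℚ
  dot-zero zero    c = refl
  dot-zero (suc D) c = trans (+-identityˡ _) (dot-zero D (c ∘ suc))

  -- For `p = toℕ b` and `M = moment u` this is pointwise `moment (b ∷ u)`. An arbitrary `p` is
  -- allowed because the induction in `dot-pascal` puts `M 0` in its place.
  pascal : ℕ → (ℕ → ℕ) → ℕ → ℕ
  pascal p M zero    = p ℕ.+ M 0
  pascal p M (suc j) = M j ℕ.+ M (suc j)

  ×-zeroʳ : ∀ n → n × 0ℚ ≡ 0ℚ
  ×-zeroʳ zero    = refl
  ×-zeroʳ (suc n) = trans (+-identityˡ _) (×-zeroʳ n)

  -- Summation by parts: `pascal` is adjoint to `next` up to a boundary term.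
  dot-pascal : ∀ D p M c → c D ≡ 0ℚ → dot D (pascal p M) c ≡ p × c 0 + dot D M (next c)
  dot-pascal zero    p M c c≡0 = sym (trans (+-identityʳ _) (trans (cong (p ×_) c≡0) (×-zeroʳ p)))
  dot-pascal (suc D) p M c c≡0 = begin
    (p ℕ.+ M 0) × c 0 + dot D (λ j → M j ℕ.+ M (suc j)) (c ∘ suc)
      ≡⟨ cong₂ _+_ (×-homo-+ (c 0) p (M 0)) (dot-cong D (c ∘ suc) (λ { zero _ → refl ; (suc _) _ → refl })) ⟩
    (p × c 0 + M 0 × c 0) + dot D (pascal (M 0) (M ∘ suc)) (c ∘ suc)
      ≡⟨ cong ((p × c 0 + M 0 × c 0) +_) (dot-pascal D (M 0) (M ∘ suc) (c ∘ suc) c≡0) ⟩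
    (p × c 0 + M 0 × c 0) + (M 0 × c 1 + dot D (M ∘ suc) (next (c ∘ suc)))
      ≡⟨ solve 4 (λ a b e f → (a :+ b) :+ (e :+ f) := a :+ ((b :+ e) :+ f)) refl (p × c 0) (M 0 × c 0) _ _ ⟩
    p × c 0 + ((M 0 × c 0 + M 0 × c 1) + dot D (M ∘ suc) (next (c ∘ suc)))
      ≡⟨ cong (λ z → p × c 0 + (z + dot D (M ∘ suc) (next (c ∘ suc)))) (×-distrib-+ (c 0) (c 1) (M 0)) ⟨
    p × c 0 + dot (suc D) M (next c) ∎
    where open ≡-Reasoning

  -- Exchange of the sums over `k` and `j`: reading one entry applies `next` to the coefficients,
  -- and `dot-pascal` turns this into Pascal's rule on the moments.
  select-eval : ∀ {D L} (u : Selection L) {c} → VanishesFrom D c → select u (eval c) ≡ dot D (moment u) c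
  select-eval {D} []      {c} c≡0 = sym (dot-zero D c)
  select-eval {D} (b ∷ u) {c} c≡0 = begin
    toℕ b × c 0 + select u (eval (next c))
      ≡⟨ cong (toℕ b × c 0 +_) (select-eval u (next-vanishes c≡0)) ⟩
    toℕ b × c 0 + dot D (moment u) (next c)
      ≡⟨ dot-pascal D (toℕ b) (moment u) c (c≡0 D ℕ.≤-refl) ⟨
    dot D (pascal (toℕ b) (moment u)) c
      ≡⟨ dot-cong D c (λ { zero _ → refl ; (suc _) _ → refl }) ⟩
    dot D (moment (b ∷ u)) c ∎
    where open ≡-Reasoning

  select-SameMoments : ∀ {D K L} (u : Selection K) (v : Selection L) {c} → VanishesFrom D c →
    SameMoments D u v → select u (eval c) ≡ select v (eval c)
  select-SameMoments {D} u v {c} c≡0 same =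
    trans (select-eval u c≡0) (trans (dot-cong D c same) (sym (select-eval v c≡0)))

  /1-homo-+ : ∀ k l → (k ℤ.+ l) / 1 ≡ k / 1 + l / 1
  /1-homo-+ k l = toℚᵘ-injective (ℚᵘ.≃-trans (toℚᵘ-fromℚᵘ (ℚᵘ.mkℚᵘ (k ℤ.+ l) 0))
    (ℚᵘ.≃-trans (ℚᵘ.*≡* (cong₂ (λ i j → (i ℤ.+ j) ℤ.* ℤ.1ℤ) (sym (ℤ.*-identityʳ k)) (sym (ℤ.*-identityʳ l))))
    (ℚᵘ.≃-sym (ℚᵘ.≃-trans (toℚᵘ-homo-+ (k / 1) (l / 1))
      (ℚᵘ.+-cong (toℚᵘ-fromℚᵘ (ℚᵘ.mkℚᵘ k 0)) (toℚᵘ-fromℚᵘ (ℚᵘ.mkℚᵘ l 0)))))))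

  /1-homo-neg : ∀ k → (ℤ.- k) / 1 ≡ - (k / 1)
  /1-homo-neg k = toℚᵘ-injective (ℚᵘ.≃-trans (toℚᵘ-fromℚᵘ (ℚᵘ.mkℚᵘ (ℤ.- k) 0))
    (ℚᵘ.≃-sym (ℚᵘ.≃-trans (toℚᵘ-homo‿- (k / 1)) (ℚᵘ.-‿cong (toℚᵘ-fromℚᵘ (ℚᵘ.mkℚᵘ k 0))))))

  /1-mono-≤ : ∀ {k l} → k ℤ.≤ l → k / 1 ≤ l / 1
  /1-mono-≤ {k} {l} k≤l = toℚᵘ-cancel-≤
    (ℚᵘ.≤-respˡ-≃ (ℚᵘ.≃-sym (toℚᵘ-fromℚᵘ (ℚᵘ.mkℚᵘ k 0)))
      (ℚᵘ.≤-respʳ-≃ (ℚᵘ.≃-sym (toℚᵘ-fromℚᵘ (ℚᵘ.mkℚᵘ l 0)))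
        (ℚᵘ.*≤* (ℤ.*-monoʳ-≤-nonNeg ℤ.1ℤ k≤l))))

  ½≤∣½-k∣ : ∀ k → ½ ≤ ∣ ½ - k / 1 ∣
  ½≤∣½-k∣ k with k ℤ.≤? ℤ.0ℤ
  ... | yes k≤0 = ≤-trans (+-monoʳ-≤ ½ (neg-antimono-≤ (/1-mono-≤ k≤0))) (p≤∣p∣ (½ - k / 1))
  ... | no  k≰0 = begin
    ½                 ≤⟨ +-monoˡ-≤ (- ½) (/1-mono-≤ (ℤ.i<j⇒suc[i]≤j (ℤ.≰⇒> k≰0))) ⟩
    k / 1 - ½         ≡⟨ solve 1 (λ k → k :- con ½ := :- (con ½ :- k)) refl (k / 1) ⟩
    - (½ - k / 1)     ≤⟨ -p≤∣p∣ (½ - k / 1) ⟩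
    ∣ ½ - k / 1 ∣     ∎
    where open ≤-Reasoning

  record NearInteger (ε q : ℚ) : Set where
    constructor near-integer
    field
      integer : ℤ
      error   : ∣ q - integer / 1 ∣ ≤ ε

  NearInteger-0 : NearInteger 0ℚ 0ℚ
  NearInteger-0 = near-integer ℤ.0ℤ ≤-refl

  NearInteger-+ : ∀ {ε δ p q} → NearInteger ε p → NearInteger δ q → NearInteger (ε + δ) (p + q)
  NearInteger-+ {ε} {δ} {p} {q} (near-integer k p≈k) (near-integer l q≈l) = near-integer (k ℤ.+ l) (begin
    ∣ (p + q) - (k ℤ.+ l) / 1 ∣        ≡⟨ cong (λ z → ∣ (p + q) - z ∣) (/1-homo-+ k l) ⟩
    ∣ (p + q) - (k / 1 + l / 1) ∣
      ≡⟨ cong ∣_∣ (solve 4 (λ p q k l → (p :+ q) :- (k :+ l) := (p :- k) :+ (q :- l))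
           refl p q (k / 1) (l / 1)) ⟩
    ∣ (p - k / 1) + (q - l / 1) ∣      ≤⟨ ∣p+q∣≤∣p∣+∣q∣ (p - k / 1) (q - l / 1) ⟩
    ∣ p - k / 1 ∣ + ∣ q - l / 1 ∣      ≤⟨ +-mono-≤ p≈k q≈l ⟩
    ε + δ                              ∎)
    where open ≤-Reasoning

  NearInteger-neg : ∀ {ε p} → NearInteger ε p → NearInteger ε (- p)
  NearInteger-neg {ε} {p} (near-integer k p≈k) = near-integer (ℤ.- k) (subst (_≤ ε) (begin
    ∣ p - k / 1 ∣                      ≡⟨ ∣-p∣≡∣p∣ (p - k / 1) ⟨
    ∣ - (p - k / 1) ∣                  ≡⟨ cong ∣_∣ (neg-distrib-+ p (- (k / 1))) ⟩
    ∣ - p - - (k / 1) ∣                ≡⟨ cong (λ z → ∣ - p - z ∣) (/1-homo-neg k) ⟨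
    ∣ - p - (ℤ.- k) / 1 ∣              ∎) p≈k)
    where open ≡-Reasoning

  NearInteger-½ : ∀ {ε} → NearInteger ε ½ → ½ ≤ ε
  NearInteger-½ (near-integer k ½≈k) = ≤-trans (½≤∣½-k∣ k) ½≈k

  NearInteger-select : ∀ {L ε f} (u : Selection L) → 0ℚ ≤ ε →
    (∀ k → k ℕ.< L → NearInteger ε (f k)) → NearInteger (L × ε) (select u f)
  NearInteger-select []       0≤ε near = NearInteger-0
  NearInteger-select {suc L} {ε} {f} (b ∷ u) 0≤ε near =
    NearInteger-+ (term b) (NearInteger-select u 0≤ε (λ k k<L → near (suc k) (s≤s k<L)))
    where
    term : ∀ b → NearInteger ε (toℕ b × f 0)
    term 0F = near-integer ℤ.0ℤ 0≤ε
    term 1F = subst (NearInteger ε) (sym (+-identityʳ (f 0))) (near 0 (s≤s z≤n))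

  -- Equal moments force Σₖ (vₖ - uₖ) p(k) = 0; subtracting ½ from the values past 0 costs
  -- ½ in total, because the 0-th moments of u and v beyond 0 differ by one.
  parity-clash : ∀ {D K ε c} {u v : Selection K} → 0ℚ ≤ ε → VanishesFrom (suc D) c →
    SameMoments (suc D) (0F ∷ u) (1F ∷ v) → NearInteger ε (eval c 0) →
    (∀ k → k ℕ.< K → NearInteger ε (eval c (suc k) - ½)) →
    ½ ≤ (ε + K × ε) + K × ε
  parity-clash {D} {K} {ε} {c} {u} {v} 0≤ε c≡0 same near₀ near =
    NearInteger-½ (subst (NearInteger ((ε + K × ε) + K × ε)) ½-total
      (NearInteger-+ (NearInteger-+ near₀ (NearInteger-select v 0≤ε near))
        (NearInteger-neg (NearInteger-select u 0≤ε near))))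
    where
    open ≡-Reasoning
    tail : ℕ → ℚ
    tail k = eval c (suc k)

    ½-total : (c 0 + select v (λ k → tail k - ½)) - select u (λ k → tail k - ½) ≡ ½
    ½-total = begin
      (c 0 + select v (λ k → tail k - ½)) - select u (λ k → tail k - ½)
        ≡⟨ cong₂ (λ y z → (c 0 + y) - z) (select-+ v tail (- ½)) (select-+ u tail (- ½)) ⟩
      (c 0 + (select v tail + moment v 0 × - ½)) - (select u tail + moment u 0 × - ½)
        -- Order 0 gives `moment u 0 ≡ suc (moment v 0)`; the one extra `- ½` survives the
        -- cancellation.
        ≡⟨ cong₂ (λ y m → (c 0 + (select v tail + moment v 0 × - ½)) - (y + m × - ½)) tails (same 0 (s≤s z≤n)) ⟩
      (c 0 + (select v tail + moment v 0 × - ½)) - ((c 0 + select v tail) + (- ½ + moment v 0 × - ½))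
        ≡⟨ solve 3 (λ a y m → (a :+ (y :+ m)) :- ((a :+ y) :+ (:- con ½ :+ m)) := con ½)
             refl (c 0) (select v tail) (moment v 0 × - ½) ⟩
      ½ ∎
      where
      tails : select u tail ≡ c 0 + select v tail
      tails = begin
        select u tail                          ≡⟨ +-identityˡ _ ⟨
        select (0F ∷ u) (eval c)               ≡⟨ select-SameMoments (0F ∷ u) (1F ∷ v) c≡0 same ⟩
        select (1F ∷ v) (eval c)               ≡⟨ cong (_+ select v tail) (+-identityʳ (c 0)) ⟩
        c 0 + select v tail                    ∎

-- Rational approximation of reals and of symmetric polynomials.

module Approximation where

  open Newton
  open import Data.Bool using (true; false)
  open import Data.Fin.Subset using (Subset; inside; outside) renaming (∣_∣ to size)
  open import Data.Fin.Subset.Properties using () renaming (∣p∣≤n to size≤n)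
  import Data.Integer as ℤ
  open import Data.List as List using (List; []; _∷_; _++_; map; foldr; filter)
  open import Data.List.Properties using (map-cong; map-∘)
  open import Data.Nat as ℕ using (ℕ; zero; suc; s≤s; z≤n)
  import Data.Nat.Properties as ℕ
  open import Data.Product using (∃-syntax; _,_; proj₁; proj₂) renaming (_×_ to _∧_)
  open import Data.Rational
  open import Data.Rational.Properties
  open import Algebra.Properties.CommutativeMonoid.Mult +-0-commutativeMonoid
  open import Data.Rational.Solver using (module +-*-Solver)
  open +-*-Solver using (solve; _:=_; _:+_; _:-_; :-_)
  open import Data.Sum using (inj₁; inj₂)
  open import Data.Vec using (_∷_; [])
  open import Function using (_∘_)
  open import Relation.Binary.PropositionalEquality
  open import Relation.Unary using (Decidable)
  open import Relation.Nullary using (¬_; yes; no; contradiction)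
  open import Defs
  open ℚ-Lemmas

  -- Strict |x - q| < ε, phrased by cut membership so that later estimates are between rationals.
  record Near (x : ℝ) (q ε : ℚ) : Set where
    constructor near
    field
      below : Lower x (q - ε)
      above : Upper x (q + ε)

  near-mono : ∀ {x q ε δ} → ε < δ → Near x q ε → Near x q δ
  near-mono {x} {q} ε<δ (near L U) =
    near (lower-closed x (+-monoʳ-< q (neg-antimono-< ε<δ)) L) (upper-closed x (+-monoʳ-< q ε<δ) U)

  near-approximate : ∀ x δ → 0ℚ < δ → ∃[ q ] Near x q δ
  near-approximate x δ 0<δ with a , L , U ← approximate x δ 0<δ =
    a , near (lower-closed x (subst (a - δ <_) (+-identityʳ a) (+-monoʳ-< a (neg-antimono-< 0<δ))) L) U

  near-fromℚ : ∀ q {ε} → 0ℚ < ε → Near (fromℚ q) q ε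
  near-fromℚ q {ε} 0<ε =
    near (subst (q - ε <_) (+-identityʳ q) (+-monoʳ-< q (neg-antimono-< 0<ε))) (p<p+q 0<ε q)

  near-neg : ∀ {x q ε} → Near x q ε → Near (-ℝ x) (- q) ε
  near-neg {x} {q} {ε} (near L U) = near
    (subst (Upper x) (solve 2 (λ q e → q :+ e := :- (:- q :- e)) refl q ε) U)
    (subst (Lower x) (solve 2 (λ q e → q :- e := :- (:- q :+ e)) refl q ε) L)

  near-+ : ∀ {x y q r ε δ} → Near x q ε → Near y r δ → Near (x +ℝ y) (q + r) (ε + δ)
  near-+ {x} {y} {q} {r} {ε} {δ} (near L U) (near L′ U′)
    -- The cuts of a sum ask for strict inequalities; the room comes from improving the bounds on
    -- `x`, while those on `y` serve as they are.
    with a , lt , A ← lower-open x L | b , gt , B ← upper-open x U = near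
    (a , r - δ , A , L′ , subst (_< a + (r - δ))
      (solve 4 (λ q r e d → (q :- e) :+ (r :- d) := (q :+ r) :- (e :+ d)) refl q r ε δ) (+-monoˡ-< (r - δ) lt))
    (b , r + δ , B , U′ , subst (b + (r + δ) <_)
      (solve 4 (λ q r e d → (q :+ e) :+ (r :+ d) := (q :+ r) :+ (e :+ d)) refl q r ε δ) (+-monoˡ-< (r + δ) gt))

  near-- : ∀ {x y q r ε δ} → Near x q ε → Near y r δ → Near (x -ℝ y) (q - r) (ε + δ)
  near-- X Y = near-+ X (near-neg Y)

  -- `_≤ℝ_` speaks of lower cuts only, so upper cuts are reached through locatedness of `x`; its
  -- lower alternative would put `p` in both cuts of `y`.
  upper-antitone : ∀ x y {q} → x ≤ℝ y → Upper y q → Upper x q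
  upper-antitone x y x≤y U with p , p<q , U′ ← upper-open y U | located x p<q
  ... | inj₁ L = contradiction (lower<upper y (x≤y p L) U′) (<-irrefl refl)
  ... | inj₂ V = V

  near-≃ : ∀ {x y q ε} → x ≃ℝ y → Near x q ε → Near y q ε
  near-≃ {x} {y} (x≤y , y≤x) (near L U) = near (x≤y _ L) (upper-antitone y x y≤x U)

  -- The way back from reals to rationals: a real equation, approximated on both sides, becomes an
  -- inequality between rationals.
  near-unique : ∀ {x q r ε δ} → Near x q ε → Near x r δ → ∣ q - r ∣ ≤ ε + δ
  near-unique {x} {q} {r} {ε} {δ} (near L U) (near L′ U′) = ∣p∣≤q
    (≤-trans (≤-reflexive (solve 3 (λ q r e → q :- r := ((q :- e) :- r) :+ e) refl q r ε))
      (≤-trans (+-monoˡ-≤ ε (+-monoˡ-≤ (- r) (<⇒≤ (lower<upper x L U′))))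
        (≤-reflexive (solve 3 (λ r e d → ((r :+ d) :- r) :+ e := e :+ d) refl r ε δ))))
    (≤-trans (≤-reflexive (solve 3 (λ q r d → :- (q :- r) := ((r :- d) :- q) :+ d) refl q r δ))
      (≤-trans (+-monoˡ-≤ δ (+-monoˡ-≤ (- q) (<⇒≤ (lower<upper x L′ U))))
        (≤-reflexive (solve 3 (λ q e d → ((q :+ e) :- q) :+ d := e :+ d) refl q ε δ))))

  ∣x∣≤⇒near : ∀ {x ε δ} → 0ℚ < δ → ∣ x ∣ℝ ≤ℝ fromℚ ε → Near x 0ℚ (ε + δ)
  ∣x∣≤⇒near {x} {ε} {δ} 0<δ ∣x∣≤ε
    with U , L ← upper-antitone ∣ x ∣ℝ (fromℚ ε) ∣x∣≤ε (p<p+q 0<δ ε) =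
    near (subst (Lower x) (sym (+-identityˡ (- (ε + δ)))) L) (subst (Upper x) (sym (+-identityˡ (ε + δ))) U)

  -- Monomials take only the values 0 and 1 on the cube. The second `ε` pays for the summand `0ℝ`
  -- inside `1 · x`.
  near-· : ∀ m {x q ε} → m ℕ.≤ 1 → 0ℚ < ε → Near x q ε → Near (m · x) (m × q) (ε + ε)
  near-· 0 m≤1 0<ε X = near-fromℚ 0ℚ (+-mono-< 0<ε 0<ε)
  near-· 1 m≤1 0<ε X = near-+ X (near-fromℚ 0ℚ 0<ε)
  near-· (suc (suc m)) (s≤s ()) 0<ε X

  total : ∀ {A : Set} → (A → ℚ) → List A → ℚ
  total f xs = foldr _+_ 0ℚ (map f xs)

  -- One `ε` more than there are terms, since even the empty sum needs positive slack.
  near-sum : ∀ {A : Set} {f : A → ℝ} {g : A → ℚ} {ε} → 0ℚ < ε → (∀ a → Near (f a) (g a) ε) →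
    ∀ xs → Near (sumℝ (map f xs)) (total g xs) (suc (List.length xs) × ε)
  near-sum {ε = ε} 0<ε f≈g []       = near-fromℚ 0ℚ (subst (0ℚ <_) (sym (+-identityʳ ε)) 0<ε)
  near-sum {g = g} 0<ε f≈g (a ∷ xs) = near-+ (f≈g a) (near-sum {g = g} 0<ε f≈g xs)

  total-cong : ∀ {A : Set} {f g : A → ℚ} → (∀ a → f a ≡ g a) → ∀ xs → total f xs ≡ total g xs
  total-cong f≡g xs = cong (foldr _+_ 0ℚ) (map-cong f≡g xs)

  total-++ : ∀ {A : Set} (f : A → ℚ) xs ys → total f (xs ++ ys) ≡ total f xs + total f ys
  total-++ f []       ys = sym (+-identityˡ _)
  total-++ f (x ∷ xs) ys = trans (cong (λ z → f x + z) (total-++ f xs ys)) (sym (+-assoc (f x) _ _))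

  total-+ : ∀ {A : Set} (f g : A → ℚ) xs → total (λ a → f a + g a) xs ≡ total f xs + total g xs
  total-+ f g []       = refl
  total-+ f g (x ∷ xs) = trans (cong (λ z → (f x + g x) + z) (total-+ f g xs)) (interchange (f x) _ _ _)

  total-zero : ∀ {A : Set} (xs : List A) → total (λ _ → 0ℚ) xs ≡ 0ℚ
  total-zero []       = refl
  total-zero (x ∷ xs) = trans (+-identityˡ _) (total-zero xs)

  total-subsets : ∀ n (f : Subset (suc n) → ℚ) →
    total f (subsets (suc n)) ≡ total (f ∘ (outside ∷_)) (subsets n) + total (f ∘ (inside ∷_)) (subsets n)
  total-subsets n f = trans (total-++ f (map (outside ∷_) (subsets n)) (map (inside ∷_) (subsets n)))
    (cong₂ _+_ (cong (foldr _+_ 0ℚ) (sym (map-∘ (subsets n)))) (cong (foldr _+_ 0ℚ) (sym (map-∘ (subsets n)))))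

  term : ∀ {n} → Cube n → (ℕ → ℚ) → Subset n → ℚ
  term x c S = monomial S x × c (size S)

  -- Exactly C(|x|, j) monomials of degree j equal 1 at `x`. In the induction, the subsets
  -- containing the first index contribute 0 if its bit is `false`; otherwise they contribute the
  -- sum with shifted coefficients, and the two halves combine into `next c`.
  total-term : ∀ {n} (x : Cube n) c → total (term x c) (subsets n) ≡ eval c (weight x)
  total-term []          c = trans (+-identityʳ _) (+-identityʳ (c 0))
  total-term {suc n} (false ∷ x) c = begin
    total (term (false ∷ x) c) (subsets (suc n))
      ≡⟨ total-subsets n (term (false ∷ x) c) ⟩
    total (λ S → (1 ℕ.* monomial S x) × c (size S)) (subsets n) + total (λ S → 0ℚ) (subsets n)
      ≡⟨ cong₂ _+_ (total-cong (λ S → cong (_× c (size S)) (ℕ.*-identityˡ (monomial S x))) (subsets n))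
                   (total-zero (subsets n)) ⟩
    total (term x c) (subsets n) + 0ℚ
      ≡⟨ trans (+-identityʳ _) (total-term x c) ⟩
    eval c (weight x) ∎
    where open ≡-Reasoning
  total-term {suc n} (true ∷ x) c = begin
    total (term (true ∷ x) c) (subsets (suc n))
      ≡⟨ total-subsets n (term (true ∷ x) c) ⟩
    total (λ S → (1 ℕ.* monomial S x) × c (size S)) (subsets n) +
      total (λ S → (1 ℕ.* monomial S x) × c (suc (size S))) (subsets n)
      ≡⟨ cong₂ _+_ (total-cong (λ S → cong (_× c (size S)) (ℕ.*-identityˡ (monomial S x))) (subsets n))
                   (total-cong (λ S → cong (_× c (suc (size S))) (ℕ.*-identityˡ (monomial S x))) (subsets n)) ⟩
    total (term x c) (subsets n) + total (term x (c ∘ suc)) (subsets n)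
      ≡⟨ total-+ (term x c) (term x (c ∘ suc)) (subsets n) ⟨
    total (λ S → term x c S + term x (c ∘ suc) S) (subsets n)
      ≡⟨ total-cong (λ S → sym (×-distrib-+ (c (size S)) (c (suc (size S))) (monomial S x))) (subsets n) ⟩
    total (term x (next c)) (subsets n)
      ≡⟨ total-term x (next c) ⟩
    eval c (suc (weight x)) ∎
    where open ≡-Reasoning

  total-filter : ∀ {A : Set} {P : A → Set} (P? : Decidable P) {f g : A → ℚ} →
    (∀ a → P a → f a ≡ g a) → (∀ a → ¬ P a → g a ≡ 0ℚ) → ∀ xs → total f (filter P? xs) ≡ total g xs
  total-filter P? f≡g g≡0 [] = refl
  total-filter P? {f} {g} f≡g g≡0 (x ∷ xs) with P? x
  ... | yes Px = cong₂ _+_ (f≡g x Px) (total-filter P? f≡g g≡0 xs)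
  ... | no ¬Px = trans (total-filter P? f≡g g≡0 xs)
    (sym (trans (cong (_+ total g xs) (g≡0 x ¬Px)) (+-identityˡ _)))

  monomial≤1 : ∀ {n} (S : Subset n) x → monomial S x ℕ.≤ 1
  monomial≤1 []            []      = ℕ.≤-refl
  monomial≤1 (outside ∷ S) (b ∷ x) = ℕ.*-mono-≤ {1} {1} ℕ.≤-refl (monomial≤1 S x)
  monomial≤1 (inside ∷ S) (false ∷ x) = ℕ.z≤n
  monomial≤1 (inside ∷ S) (true ∷ x) = ℕ.*-mono-≤ {1} {1} ℕ.≤-refl (monomial≤1 S x)

  -- Points and subsets are both Boolean vectors, so the same vector serves as sample point of
  -- weight `k` and as sample subset of size `k`.
  prefix : ∀ n → ℕ → Cube n
  prefix zero    k       = []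
  prefix (suc n) zero    = outside ∷ prefix n zero
  prefix (suc n) (suc k) = inside ∷ prefix n k

  weight-prefix : ∀ {n k} → k ℕ.≤ n → weight (prefix n k) ≡ k
  weight-prefix {zero}  {zero}  k≤n       = refl
  weight-prefix {suc n} {zero}  k≤n       = weight-prefix {n} {zero} z≤n
  weight-prefix {suc n} {suc k} (s≤s k≤n) = cong suc (weight-prefix k≤n)

  size-prefix : ∀ {n k} → k ℕ.≤ n → size (prefix n k) ≡ k
  size-prefix {zero}  {zero}  k≤n       = refl
  size-prefix {suc n} {zero}  k≤n       = size-prefix {n} {zero} z≤n
  size-prefix {suc n} {suc k} (s≤s k≤n) = cong suc (size-prefix k≤n)

  ×-/1 : ∀ n h → n × h ≡ (ℤ.+ n / 1) * h
  ×-/1 n h = trans (×≡times n) (times-/1 n h)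
    where
    ×≡times : ∀ n → n × h ≡ times n h
    ×≡times zero    = refl
    ×≡times (suc n) = cong (λ z → h + z) (×≡times n)

  subdivide : ∀ n {ε} → 0ℚ < ε → ∃[ δ ] 0ℚ < δ ∧ suc n × (δ + δ) < ε
  -- The first halving makes the final bound strict; the second splits `η` into `δ + δ`.
  subdivide n {ε} 0<ε with h , 0<h , h+h ← halve 0<ε
    with η , 0<η , _ , ηn≤h ← precision h (ℤ.+ suc n / 1) 0<h
      (positive⁻¹ (ℤ.+ suc n / 1) {{normalize-pos (suc n) 1}})
    with δ , 0<δ , δ+δ ← halve 0<η =
    δ , 0<δ , ≤-<-trans (≤-trans (≤-reflexive (trans (×-/1 (suc n) (δ + δ))
      (trans (*-comm _ (δ + δ)) (cong (_* (ℤ.+ suc n / 1)) δ+δ)))) ηn≤h)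
      (subst (h <_) h+h (p<p+q 0<h h))

  -- Approximated coefficients need not vanish at sizes above `d`, which the degree filter drops;
  -- cutting them off makes the degree bound visible to `eval`.
  restrict : ℕ → (ℕ → ℚ) → ℕ → ℚ
  restrict d c j with j ℕ.≤? d
  ... | yes _ = c j
  ... | no  _ = 0ℚ

  restrict-vanishes : ∀ d c → VanishesFrom (suc d) (restrict d c)
  restrict-vanishes d c j d<j with j ℕ.≤? d
  ... | yes j≤d = contradiction j≤d (ℕ.<⇒≱ d<j)
  ... | no  _   = refl

  restrict-≤ : ∀ d c {j} → j ℕ.≤ d → c j ≡ restrict d c j
  restrict-≤ d c {j} j≤d with j ℕ.≤? d
  ... | yes _   = refl
  ... | no  j≰d = contradiction j≤d j≰d

  lowSubsets : ∀ n → ℕ → List (Subset n)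
  lowSubsets n d = filter (λ S → size S ℕ.≤? d) (subsets n)

  total-low : ∀ {n} d (x : Cube n) c → total (term x c) (lowSubsets n d) ≡ eval (restrict d c) (weight x)
  total-low {n} d x c = trans
    (total-filter (λ S → size S ℕ.≤? d) (λ S S≤d → cong (monomial S x ×_) (restrict-≤ d c S≤d))
      (λ S S≰d → trans (cong (monomial S x ×_) (restrict-vanishes d c (size S) (ℕ.≰⇒> S≰d)))
        (×-zeroʳ (monomial S x)))
      (subsets n))
    (total-term x (restrict d c))

  near-polynomial : ∀ {n} d {coeff : Subset n → ℝ} {c δ} → 0ℚ < δ →
    (∀ S → Near (coeff S) (c (size S)) δ) →
    ∀ x → Near (polynomial d coeff x) (eval (restrict d c) (weight x))
      (suc (List.length (lowSubsets n d)) × (δ + δ))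
  near-polynomial {n} d {coeff} {c} {δ} 0<δ coeff≈c x =
    subst (λ q → Near (polynomial d coeff x) q (suc (List.length (lowSubsets n d)) × (δ + δ))) (total-low d x c)
      (near-sum {f = λ S → monomial S x · coeff S} {g = term x c} (+-mono-< 0<δ 0<δ)
        (λ S → near-· (monomial S x) (monomial≤1 S x) 0<δ (coeff≈c S)) (lowSubsets n d))

  -- Approximating each coefficient separately could give different rationals for equal reals. So
  -- one is approximated per size, at `prefix n j`, and symmetry carries it to the other subsets.
  near-symmetric : ∀ {n} {coeff : Subset n → ℝ} → (∀ S T → size S ≡ size T → coeff S ≃ℝ coeff T) →
    ∀ δ → 0ℚ < δ → ∃[ c ] (∀ S → Near (coeff S) (c (size S)) δ)
  near-symmetric {n} {coeff} symmetric δ 0<δ =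
    (λ j → proj₁ (near-approximate (coeff (prefix n j)) δ 0<δ)) ,
    (λ S → near-≃ (symmetric (prefix n (size S)) S (size-prefix (size≤n S)))
      (proj₂ (near-approximate (coeff (prefix n (size S))) δ 0<δ)))

  symmetric-approximation : ∀ {n} d (coeff : Subset n → ℝ) →
    (∀ S T → size S ≡ size T → coeff S ≃ℝ coeff T) → ∀ {ε} → 0ℚ < ε →
    ∃[ c ] VanishesFrom (suc d) c ∧ (∀ x → Near (polynomial d coeff x) (eval c (weight x)) ε)
  symmetric-approximation {n} d coeff symmetric 0<ε =
    let δ , 0<δ , small = subdivide (List.length (lowSubsets n d)) 0<ε
        c , coeff≈c = near-symmetric symmetric δ 0<δ
    in restrict d c , restrict-vanishes d c , λ x → near-mono small (near-polynomial d 0<δ coeff≈c x)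

-- Counting moment vectors against powers of two.

module Counting where

  open import Data.Nat
  open import Data.Nat.Properties
  open import Data.Nat.Tactic.RingSolver using (solve-∀)
  open import Relation.Binary.PropositionalEquality

  -- With d = `suc e` and D = d + 1 moments this is (D + 1) D ≤ 6 d², an equality at d = 1.
  degree-exponent : ∀ e → (3 + e) * (2 + e) ≤ 6 * (suc e * suc e)
  degree-exponent e = ≤-trans (m≤m+n _ (5 * (e * e) + 7 * e)) (≤-reflexive (identity e))
    where
    identity : ∀ e → (3 + e) * (2 + e) + (5 * (e * e) + 7 * e) ≡ 6 * (suc e * suc e)
    identity = solve-∀

  code-bound : ∀ {n L} e → 2 ≤ n → L ≤ n → suc (L ^ (2 + e)) ^ (2 + e) ≤ n ^ (6 * (suc e * suc e))
  code-bound {n@(suc _)} {L} e 2≤n L≤n = begin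
    suc (L ^ (2 + e)) ^ (2 + e)    ≤⟨ ^-monoˡ-≤ (2 + e) cell ⟩
    (n ^ (3 + e)) ^ (2 + e)        ≡⟨ ^-*-assoc n (3 + e) (2 + e) ⟩
    n ^ ((3 + e) * (2 + e))        ≤⟨ ^-monoʳ-≤ n (degree-exponent e) ⟩
    n ^ (6 * (suc e * suc e))      ∎
    where
    open ≤-Reasoning
    -- Since `2 ≤ n`, the additional 1 costs only one further factor `n`.
    cell : suc (L ^ (2 + e)) ≤ n ^ (3 + e)
    cell = begin
      1 + L ^ (2 + e)              ≤⟨ +-mono-≤ (m^n>0 n (2 + e)) (^-monoˡ-≤ (2 + e) L≤n) ⟩
      n ^ (2 + e) + n ^ (2 + e)    ≡⟨ cong (n ^ (2 + e) +_) (+-identityʳ _) ⟨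
      2 * n ^ (2 + e)              ≤⟨ *-monoˡ-≤ (n ^ (2 + e)) 2≤n ⟩
      n ^ (3 + e)                  ∎

  -- If 2^L were at most n^(6 d²), squaring would give 2^n ≤ n^(12 d²), against the hypothesis with
  -- 16. The number 16 exceeds 12 and is the square of 4, whence the constant ¼ of the theorem.
  few-codes : ∀ {n L} e → 2 ≤ n → L ≤ n → n ≤ 2 * L → n ^ (16 * (suc e * suc e)) ≤ 2 ^ n →
    suc (L ^ (2 + e)) ^ (2 + e) < 2 ^ L
  few-codes {n@(suc _)} {L} e 2≤n L≤n n≤2L sparse = ≤-<-trans (code-bound e 2≤n L≤n)
    (≰⇒> λ le → <⇒≱ (^-monoʳ-< n 2≤n 12<16) (begin
      n ^ (16 * m)          ≤⟨ sparse ⟩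
      2 ^ n                 ≤⟨ ^-monoʳ-≤ 2 n≤2L ⟩
      2 ^ (2 * L)           ≡⟨ cong (2 ^_) (*-comm 2 L) ⟩
      2 ^ (L * 2)           ≡⟨ ^-*-assoc 2 L 2 ⟨
      (2 ^ L) ^ 2           ≤⟨ ^-monoˡ-≤ 2 le ⟩
      (n ^ (6 * m)) ^ 2     ≡⟨ ^-*-assoc n (6 * m) 2 ⟩
      n ^ ((6 * m) * 2)     ≡⟨ cong (n ^_) (trans (*-comm (6 * m) 2) (sym (*-assoc 2 6 m))) ⟩
      n ^ (12 * m)          ∎))
    where
    open ≤-Reasoning
    m : ℕ
    m = suc e * suc e
    12<16 : 12 * m < 16 * m
    12<16 = *-monoˡ-< m {12} {16} (m≤m+n 13 3)

  -- Here `e / suc f` bounds log₂ n from above. Both sides are compared after raising to the power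
  -- `suc f`, which is strictly monotone.
  clear-denominator : ∀ n k e f → k * e ≤ n * suc f → n ^ suc f ≤ 2 ^ e → n ^ k ≤ 2 ^ n
  clear-denominator n k e f ke≤nf n^f≤2^e = ≮⇒≥ λ lt → <⇒≱ (^-monoˡ-< (suc f) lt) (begin
    (n ^ k) ^ suc f      ≡⟨ ^-*-assoc n k (suc f) ⟩
    n ^ (k * suc f)      ≡⟨ cong (n ^_) (*-comm k (suc f)) ⟩
    n ^ (suc f * k)      ≡⟨ ^-*-assoc n (suc f) k ⟨
    (n ^ suc f) ^ k      ≤⟨ ^-monoˡ-≤ k n^f≤2^e ⟩
    (2 ^ e) ^ k          ≡⟨ ^-*-assoc 2 e k ⟩
    2 ^ (e * k)          ≡⟨ cong (2 ^_) (*-comm e k) ⟩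
    2 ^ (k * e)          ≤⟨ ^-monoʳ-≤ 2 ke≤nf ⟩
    2 ^ (n * suc f)      ≡⟨ ^-*-assoc 2 n (suc f) ⟨
    (2 ^ n) ^ suc f      ∎)
    where open ≤-Reasoning

-- From n^(16 d²) > 2^n to the bound with root and logarithm.

module LowerBound where

  open import Defs
  open ℚ-Lemmas
  open Counting using (clear-denominator)
  open Newton using (/1-homo-+; /1-mono-≤)
  import Data.Integer as ℤ
  import Data.Integer.Properties as ℤ
  open import Data.Nat as ℕ using (ℕ; suc; z≤n)
  import Data.Nat.Properties as ℕ
  open import Data.Product using (∃-syntax; _,_) renaming (_×_ to _∧_)
  open import Data.Rational
  open import Data.Rational.Properties
  import Data.Rational.Unnormalised as ℚᵘ
  import Data.Rational.Unnormalised.Properties as ℚᵘ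
  open import Data.Rational.Solver using (module +-*-Solver)
  open +-*-Solver using (solve; _:=_; con; _:*_)
  open import Data.Sum using (inj₁; inj₂)
  open import Relation.Binary.PropositionalEquality
  open import Relation.Nullary using (¬_; contradiction)

  /1-homo-* : ∀ k l → (k ℤ.* l) / 1 ≡ (k / 1) * (l / 1)
  /1-homo-* k l = toℚᵘ-injective (ℚᵘ.≃-trans (toℚᵘ-fromℚᵘ (ℚᵘ.mkℚᵘ (k ℤ.* l) 0))
    (ℚᵘ.≃-sym (ℚᵘ.≃-trans (toℚᵘ-homo-* (k / 1) (l / 1))
      (ℚᵘ.*-cong (toℚᵘ-fromℚᵘ (ℚᵘ.mkℚᵘ k 0)) (toℚᵘ-fromℚᵘ (ℚᵘ.mkℚᵘ l 0))))))

  /-*-cancel : ∀ k n → (k / suc n) * (ℤ.+ suc n / 1) ≡ k / 1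
  /-*-cancel k n = toℚᵘ-injective (ℚᵘ.≃-trans (toℚᵘ-homo-* (k / suc n) (ℤ.+ suc n / 1))
    (ℚᵘ.≃-trans (ℚᵘ.*-cong (toℚᵘ-fromℚᵘ (ℚᵘ.mkℚᵘ k n)) (toℚᵘ-fromℚᵘ (ℚᵘ.mkℚᵘ (ℤ.+ suc n) 0)))
    (ℚᵘ.≃-trans (ℚᵘ.*≡* (trans (ℤ.*-identityʳ _) (cong (λ m → k ℤ.* ℤ.+ m) (sym (ℕ.*-identityʳ (suc n))))))
      (ℚᵘ.≃-sym (toℚᵘ-fromℚᵘ (ℚᵘ.mkℚᵘ k 0))))))

  /1-cancel-≤ : ∀ m n → ℤ.+ m / 1 ≤ ℤ.+ n / 1 → m ℕ.≤ n
  /1-cancel-≤ m n le = ℕ.≮⇒≥ λ n<m → <-irrefl refl (<-≤-trans (p<p+q (positive⁻¹ 1ℚ) (ℤ.+ n / 1))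
    (≤-trans (≤-trans (≤-reflexive (trans (sym (/1-homo-+ (ℤ.+ n) (ℤ.+ 1))) (cong (λ k → ℤ.+ k / 1) (ℕ.+-comm n 1))))
      (/1-mono-≤ (ℤ.+≤+ n<m))) le))

  /1-nonNeg : ∀ n → 0ℚ ≤ ℤ.+ n / 1
  /1-nonNeg n = /1-mono-≤ {ℤ.0ℤ} {ℤ.+ n} (ℤ.+≤+ z≤n)

  -- As `a` lies in the first interval, the least product of endpoints is at most `a` times the
  -- lower endpoint of the second, which is the witness.
  lower-scale : ∀ a x {q} → Lower (fromℚ a *ℝ x) q → ∃[ r ] Lower x r ∧ q < a * r
  lower-scale a x (I , J , lt) = Enclosure.lo J , Enclosure.lo∈ J ,
    Product.bilinear-> {fromℚ a} {x} I J (<⇒≤ (Enclosure.lo∈ I)) (<⇒≤ (Enclosure.hi∈ I)) ≤-refl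
      (<⇒≤ (lower<upper x (Enclosure.lo∈ J) (Enclosure.hi∈ J))) lt

  lower-√ : ∀ x {q} → 0ℚ ≤ q → Lower (√ x) q → ∃[ p ] q < p ∧ Lower x (p * p)
  lower-√ x 0≤q (p , q<p , inj₁ p≤0) = contradiction (≤-<-trans 0≤q (<-≤-trans q<p p≤0)) (<-irrefl refl)
  lower-√ x 0≤q (p , q<p , inj₂ L)   = p , q<p , L

  -- A rational below the reciprocal comes with some `b` above log₂ n, and membership of `b` in that
  -- upper cut supplies the fraction and the comparison of powers.
  lower-÷log₂ : ∀ a n .{{_ : ℕ.NonZero n}} (0<log : 0ℝ <ℝ log₂ n) {q} → 0ℚ ≤ a → 0ℚ ≤ q →
    Lower (fromℚ a ÷ log₂ n ⟨ 0<log ⟩) q →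
    ∃[ e ] ∃[ f ] q * (ℤ.+ e / suc f) ≤ a ∧ n ℕ.^ suc f ℕ.≤ 2 ℕ.^ e
  lower-÷log₂ a n 0<log {q} 0≤a 0≤q L =
    let r , (b , 0<b , (e , f , e/f<b , power) , r<1/b) , q<ar = lower-scale a (log₂ n ⁻¹⟨ 0<log ⟩) L
    in e , f , bound r b 0<b (ℤ.+ e / suc f) r<1/b q<ar e/f<b , power
    where
    open ≤-Reasoning
    bound : ∀ r b (0<b : 0ℚ < b) x → r < recip b 0<b → q < a * r → x < b → q * x ≤ a
    bound r b 0<b x r<1/b q<ar x<b = begin
      q * x                       ≤⟨ *-monoʳ-≤-0≤ q x b 0≤q (<⇒≤ x<b) ⟩
      q * b                       ≤⟨ *-monoˡ-≤-0≤ b q (a * r) (<⇒≤ 0<b) (<⇒≤ q<ar) ⟩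
      (a * r) * b                 ≤⟨ *-monoˡ-≤-0≤ b (a * r) (a * recip b 0<b) (<⇒≤ 0<b)
                                       (*-monoʳ-≤-0≤ a r (recip b 0<b) 0≤a (<⇒≤ r<1/b)) ⟩
      (a * recip b 0<b) * b       ≡⟨ *-assoc a (recip b 0<b) b ⟩
      a * (recip b 0<b * b)       ≡⟨ cong (a *_) (trans (*-comm (recip b 0<b) b) (*-recip b 0<b)) ⟩
      a * 1ℚ                      ≡⟨ *-identityʳ a ⟩
      a                           ∎

  ¼ : ℚ
  ¼ = ℤ.+ 1 / 4

  -- The factor ¼ turns into 16: the two strict bounds give 4x ≤ p, which is then squared.
  square-bound : ∀ {x p y z w} → 0ℚ ≤ x → 0ℚ ≤ w → x < ¼ * z → z < p → (p * p) * w ≤ y →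
    (ℤ.+ 16 / 1) * (x * x) * w ≤ y
  square-bound {x} {p} {y} {z} {w} 0≤x 0≤w x<¼z z<p p²w≤y = ≤-trans
    (*-monoˡ-≤-0≤ w _ (p * p) 0≤w (begin
      (ℤ.+ 16 / 1) * (x * x)
        ≡⟨ solve 1 (λ x → con (ℤ.+ 16 / 1) :* (x :* x) := (con 4ℚ :* x) :* (con 4ℚ :* x)) refl x ⟩
      (4ℚ * x) * (4ℚ * x)         ≤⟨ *-monoʳ-≤-0≤ (4ℚ * x) (4ℚ * x) p 0≤4x 4x≤p ⟩
      (4ℚ * x) * p                ≤⟨ *-monoˡ-≤-0≤ p (4ℚ * x) p (≤-trans 0≤4x 4x≤p) 4x≤p ⟩
      p * p                       ∎)) p²w≤y
    where
    open ≤-Reasoning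
    4ℚ : ℚ
    4ℚ = ℤ.+ 4 / 1
    0≤4x : 0ℚ ≤ 4ℚ * x
    0≤4x = *-monoʳ-≤-0≤ 4ℚ 0ℚ x (<⇒≤ (positive⁻¹ 4ℚ)) 0≤x
    4x≤p : 4ℚ * x ≤ p
    4x≤p = begin
      4ℚ * x                      ≤⟨ *-monoʳ-≤-0≤ 4ℚ x (¼ * z) (<⇒≤ (positive⁻¹ 4ℚ)) (<⇒≤ x<¼z) ⟩
      4ℚ * (¼ * z)                ≡⟨ solve 1 (λ z → con 4ℚ :* (con ¼ :* z) := z) refl z ⟩
      z                           ≤⟨ <⇒≤ z<p ⟩
      p                           ∎

  cast-bound : ∀ n d e f → (ℤ.+ 16 / 1) * ((ℤ.+ d / 1) * (ℤ.+ d / 1)) * (ℤ.+ e / suc f) ≤ ℤ.+ n / 1 →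
    16 ℕ.* (d ℕ.* d) ℕ.* e ℕ.≤ n ℕ.* suc f
  cast-bound n d e f le = /1-cancel-≤ _ _ (begin
    ⟦ 16 ℕ.* (d ℕ.* d) ℕ.* e ⟧                      ≡⟨ ⟦⟧-* (16 ℕ.* (d ℕ.* d)) e ⟩
    ⟦ 16 ℕ.* (d ℕ.* d) ⟧ * ⟦ e ⟧
      ≡⟨ cong (_* ⟦ e ⟧) (trans (⟦⟧-* 16 (d ℕ.* d)) (cong (⟦ 16 ⟧ *_) (⟦⟧-* d d))) ⟩
    k * ⟦ e ⟧                                       ≡⟨ cong (k *_) (/-*-cancel (ℤ.+ e) f) ⟨
    k * ((ℤ.+ e / suc f) * ⟦ suc f ⟧)               ≡⟨ *-assoc k (ℤ.+ e / suc f) ⟦ suc f ⟧ ⟨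
    k * (ℤ.+ e / suc f) * ⟦ suc f ⟧                 ≤⟨ *-monoˡ-≤-0≤ ⟦ suc f ⟧ _ ⟦ n ⟧ (/1-nonNeg (suc f)) le ⟩
    ⟦ n ⟧ * ⟦ suc f ⟧                               ≡⟨ ⟦⟧-* n (suc f) ⟨
    ⟦ n ℕ.* suc f ⟧                                 ∎)
    where
    open ≤-Reasoning
    ⟦_⟧ : ℕ → ℚ
    ⟦ m ⟧ = ℤ.+ m / 1
    ⟦⟧-* : ∀ m n → ⟦ m ℕ.* n ⟧ ≡ ⟦ m ⟧ * ⟦ n ⟧
    ⟦⟧-* m n = trans (cong (_/ 1) (ℤ.pos-* m n)) (/1-homo-* (ℤ.+ m) (ℤ.+ n))
    k : ℚ
    k = ⟦ 16 ⟧ * (⟦ d ⟧ * ⟦ d ⟧)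

  -- The cuts are opened from the outside in (factor, root, quotient, logarithm), each handing over
  -- a rational witness, until an inequality between naturals remains.
  power-bound : ∀ n d .{{_ : ℕ.NonZero n}} (0<log : 0ℝ <ℝ log₂ n) {q} → ℤ.+ d / 1 ≤ q →
    Lower (fromℚ ¼ *ℝ √ (fromℕ n ÷ log₂ n ⟨ 0<log ⟩)) q → n ℕ.^ (16 ℕ.* (d ℕ.* d)) ℕ.≤ 2 ℕ.^ n
  power-bound n d 0<log {q} d≤q L =
    let z , Lz , q<¼z = lower-scale ¼ (√ (fromℕ n ÷ log₂ n ⟨ 0<log ⟩)) L
        p , z<p , Lp = lower-√ (fromℕ n ÷ log₂ n ⟨ 0<log ⟩) (0≤z z q<¼z) Lz
        e , f , p²w≤n , power = lower-÷log₂ (ℤ.+ n / 1) n 0<log (/1-nonNeg n)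
          (0≤p² p (≤-trans (0≤z z q<¼z) (<⇒≤ z<p))) Lp
    in clear-denominator n (16 ℕ.* (d ℕ.* d)) e f
         (cast-bound n d e f (square-bound {z = z} (/1-nonNeg d) (0≤e/f e f) (≤-<-trans d≤q q<¼z) z<p p²w≤n)) power
    where
    0≤e/f : ∀ e f → 0ℚ ≤ ℤ.+ e / suc f
    0≤e/f e f = /-mono-≤ 0 0 e f z≤n
    0≤p² : ∀ p → 0ℚ ≤ p → 0ℚ ≤ p * p
    0≤p² p 0≤p = subst (_≤ p * p) (*-zeroʳ p) (*-monoʳ-≤-0≤ p 0ℚ p 0≤p 0≤p)
    0≤z : ∀ z → q < ¼ * z → 0ℚ ≤ z
    0≤z z q<¼z = <⇒≤ (*-cancelˡ-<-nonNeg ¼ {0ℚ} {z} (≤-<-trans (≤-trans (/1-nonNeg d) d≤q) q<¼z))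

  -- Lying in the lower cut of `fromℕ d` is an order relation between rationals, hence decidable, so
  -- it is enough to refute d ≤ q.
  degree-lower-bound : ∀ n d .{{_ : ℕ.NonZero n}} (0<log : 0ℝ <ℝ log₂ n) →
    ¬ (n ℕ.^ (16 ℕ.* (d ℕ.* d)) ℕ.≤ 2 ℕ.^ n) →
    fromℚ ¼ *ℝ √ (fromℕ n ÷ log₂ n ⟨ 0<log ⟩) ≤ℝ fromℕ d
  degree-lower-bound n d 0<log ≰2^n q L = ≰⇒> λ d≤q → ≰2^n (power-bound n d 0<log d≤q L)

-- The rational polynomial tested against majority near the middle weight.

module Majority where

  open Collision
  open Newton
  open Approximation
  open LowerBound using (/-*-cancel)
  open import Defs
  open ℚ-Lemmas
  open import Data.Bool using (true; false)
  import Data.Integer as ℤ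
  open import Data.Nat as ℕ using (ℕ; suc; s≤s; z≤n; ⌊_/2⌋; ⌈_/2⌉)
  import Data.Nat.Properties as ℕ
  open import Data.Product using (∃-syntax; _,_) renaming (_×_ to _∧_)
  open import Data.Rational
  open import Data.Rational.Properties
  open import Algebra.Properties.CommutativeMonoid.Mult +-0-commutativeMonoid
  open import Data.Rational.Solver using (module +-*-Solver)
  open +-*-Solver using (solve; _:=_; con; _:+_; _:*_; _:-_; :-_)
  open import Relation.Binary.PropositionalEquality
  open import Relation.Nullary.Decidable using (dec-true; dec-false)

  -- The auxiliary `r` cancels in s - h = (r - h) - (r - s), whose two parts lie near `l` and `k`.
  -- The last `η` in each half of the error pays for the strict approximation of the integer.
  torus-near : ∀ z y w r s h {ε η} → 0ℚ < η → z ≈𝕋 y → (z -ℝ fromℚ h) ≈𝕋 w → ∣ w ∣ℝ ≤ℝ fromℚ ε →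
    Near z r η → Near y s η → NearInteger ((((η + η) + (ε + η)) + η) + ((η + η) + η)) (s - h)
  torus-near z y w r s h {ε} {η} 0<η (k , z-y≃k) (l , z-h-w≃l) ∣w∣≤ε z≈r y≈s =
    subst (NearInteger _) (solve 3 (λ r h s → ((r :- h) :- con 0ℚ) :- (r :- s) := s :- h) refl r h s)
      (NearInteger-+ (near-integer {q = (r - h) - 0ℚ} l (near-unique r-h≈l (near-fromℚ (l / 1) 0<η)))
        (NearInteger-neg (near-integer {q = r - s} k (near-unique r-s≈k (near-fromℚ (k / 1) 0<η)))))
    where
    r-h≈l : Near (fromℤ l) ((r - h) - 0ℚ) ((η + η) + (ε + η))
    r-h≈l = near-≃ {(z -ℝ fromℚ h) -ℝ w} {fromℤ l} z-h-w≃l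
      (near-- (near-- z≈r (near-fromℚ h 0<η)) (∣x∣≤⇒near {w} 0<η ∣w∣≤ε))
    r-s≈k : Near (fromℤ k) (r - s) (η + η)
    r-s≈k = near-≃ {z -ℝ y} {fromℤ k} z-y≃k (near-- z≈r y≈s)

  -- The left side holds seven copies of `η` and one `ε`, hence η = ε / 7.
  error-budget : ∀ {ε} → 0ℚ < ε → ∃[ η ] (0ℚ < η) ∧ (((η + η) + (ε + η)) + η) + ((η + η) + η) ≡ ε + ε
  error-budget {ε} 0<ε = ⅐ * ε , subst (_< ⅐ * ε) (*-zeroʳ ⅐) (*-monoʳ-<-0< ⅐ 0ℚ ε (positive⁻¹ ⅐) 0<ε) ,
    solve 1 (λ e → let η = con ⅐ :* e in (((η :+ η) :+ (e :+ η)) :+ η) :+ ((η :+ η) :+ η) := e :+ e) refl ε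
    where
    ⅐ : ℚ
    ⅐ = ℤ.+ 1 / 7

  majority-half : ℕ → ℕ → ℚ
  majority-half n k = ℤ.+ bit (n ℕ.≤ᵇ 2 ℕ.* k) / 2

  -- Every weight up to `n` is attained at a prefix, so approximation on the cube yields one
  -- condition per weight.
  majority-polynomial : ∀ {n} d {P : Cube n → 𝕋} {ε} → 0ℚ < ε → IsSymmetricTorusPolynomial d P →
    P Approximates Maj n within fromℚ ε →
    ∃[ c ] VanishesFrom (suc d) c ∧ (∀ k → k ℕ.≤ n → NearInteger (ε + ε) (eval c k - majority-half n k))
  majority-polynomial {n} d {P} {ε} 0<ε (coeff , symmetric , P≈poly) approx =
    let η , 0<η , 7η≡ε = error-budget 0<ε
        c , c≡0 , poly≈c = symmetric-approximation d coeff symmetric 0<η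
        near-cube : ∀ x → NearInteger (ε + ε) (eval c (weight x) - majority-half n (weight x))
        near-cube x = let w , w-rep , ∣w∣≤ε = approx x
                          r , Px≈r = near-approximate (P x) η 0<η in
          subst (λ δ → NearInteger δ (eval c (weight x) - majority-half n (weight x))) 7η≡ε
            (torus-near (P x) (polynomial d coeff x) w r (eval c (weight x)) (majority-half n (weight x))
              0<η (P≈poly x) (IsRepresentative.congruent w-rep) ∣w∣≤ε Px≈r (poly≈c x))
    in c , c≡0 , λ k k≤n →
         subst (λ k → NearInteger (ε + ε) (eval c k - majority-half n k)) (weight-prefix k≤n)
           (near-cube (prefix n k))

  ×-mono-≤ : ∀ {m n h} → m ℕ.≤ n → 0ℚ ≤ h → m × h ≤ n × h
  ×-mono-≤ {m} {n} {h} m≤n 0≤h = begin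
    m × h               ≡⟨ ×-/1 m h ⟩
    (ℤ.+ m / 1) * h     ≤⟨ *-monoˡ-≤-0≤ h _ _ 0≤h (/1-mono-≤ (ℤ.+≤+ m≤n)) ⟩
    (ℤ.+ n / 1) * h     ≡⟨ ×-/1 n h ⟨
    n × h               ∎
    where open ≤-Reasoning

  ≤ᵇ-true : ∀ {m n} → m ℕ.≤ n → (m ℕ.≤ᵇ n) ≡ true
  ≤ᵇ-true {m} {n} = dec-true (m ℕ.≤? n)

  ≤ᵇ-false : ∀ {m n} → n ℕ.< m → (m ℕ.≤ᵇ n) ≡ false
  ≤ᵇ-false {m} {n} n<m = dec-false (m ℕ.≤? n) (ℕ.<⇒≱ n<m)

  2*⌊n/2⌋≤n : ∀ n → 2 ℕ.* ⌊ n /2⌋ ℕ.≤ n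
  2*⌊n/2⌋≤n n = begin
    ⌊ n /2⌋ ℕ.+ (⌊ n /2⌋ ℕ.+ 0)   ≡⟨ cong (⌊ n /2⌋ ℕ.+_) (ℕ.+-identityʳ _) ⟩
    ⌊ n /2⌋ ℕ.+ ⌊ n /2⌋           ≤⟨ ℕ.+-monoʳ-≤ ⌊ n /2⌋ (ℕ.⌊n/2⌋≤⌈n/2⌉ n) ⟩
    ⌊ n /2⌋ ℕ.+ ⌈ n /2⌉           ≡⟨ ℕ.⌊n/2⌋+⌈n/2⌉≡n n ⟩
    n                             ∎
    where open ℕ.≤-Reasoning

  n≤2*⌈n/2⌉ : ∀ n → n ℕ.≤ 2 ℕ.* ⌈ n /2⌉
  n≤2*⌈n/2⌉ n = begin
    n                             ≡⟨ ℕ.⌊n/2⌋+⌈n/2⌉≡n n ⟨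
    ⌊ n /2⌋ ℕ.+ ⌈ n /2⌉           ≤⟨ ℕ.+-mono-≤ (ℕ.⌊n/2⌋≤⌈n/2⌉ n) (ℕ.m≤m+n ⌈ n /2⌉ 0) ⟩
    2 ℕ.* ⌈ n /2⌉                 ∎
    where open ℕ.≤-Reasoning

  -- ⌊ n /2⌋ is the largest weight at which Maj (suc n) vanishes.
  majority-half-below : ∀ n → majority-half (suc n) (⌊ n /2⌋ ℕ.+ 0) ≡ 0ℚ
  majority-half-below n = cong (λ b → ℤ.+ bit b / 2)
    (≤ᵇ-false {suc n} {2 ℕ.* (⌊ n /2⌋ ℕ.+ 0)} (s≤s
      (subst (λ a → 2 ℕ.* a ℕ.≤ n) (sym (ℕ.+-identityʳ ⌊ n /2⌋)) (2*⌊n/2⌋≤n n))))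

  majority-half-above : ∀ n k → majority-half (suc n) (⌊ n /2⌋ ℕ.+ suc k) ≡ ½
  majority-half-above n k = cong (λ b → ℤ.+ bit b / 2) (≤ᵇ-true {suc n} {2 ℕ.* (⌊ n /2⌋ ℕ.+ suc k)} (begin
    suc n                              ≤⟨ n≤2*⌈n/2⌉ (suc n) ⟩
    2 ℕ.* suc ⌊ n /2⌋                  ≤⟨ ℕ.*-monoʳ-≤ 2 (ℕ.m≤m+n (suc ⌊ n /2⌋) k) ⟩
    2 ℕ.* suc (⌊ n /2⌋ ℕ.+ k)          ≡⟨ cong (2 ℕ.*_) (ℕ.+-suc ⌊ n /2⌋ k) ⟨
    2 ℕ.* (⌊ n /2⌋ ℕ.+ suc k)          ∎))
    where open ℕ.≤-Reasoning

  -- The common prefix of the colliding selections is dropped, and what remains is placed on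
  -- the consecutive weights starting at ⌊ n /2⌋.
  no-majority-polynomial : ∀ n d l {c ε} → l ℕ.≤ ⌈ n /2⌉ →
    suc (suc l ℕ.^ suc d) ℕ.^ suc d ℕ.< 2 ℕ.^ suc l → 0ℚ ≤ ε → VanishesFrom (suc d) c →
    (∀ k → k ℕ.≤ suc n → NearInteger ε (eval c k - majority-half (suc n) k)) →
    ½ ≤ (2 ℕ.* suc n) × ε
  no-majority-polynomial n d l {c} {ε} l≤n/2 few 0≤ε c≡0 near-majority
    with u , v , u≢v , same ← collision (suc d) (suc l) few
    with K , K<L , u′ , v′ , same′ ← strip-common-prefix u v u≢v same = begin
    ½
      ≤⟨ parity-clash {c = translate a c} {u = u′} {v = v′} 0≤ε (translate-vanishes a c≡0) same′ near₀ near₊ ⟩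
    suc K × ε + K × ε              ≡⟨ ×-homo-+ ε (suc K) K ⟨
    (suc K ℕ.+ K) × ε              ≤⟨ ×-mono-≤ length-bound 0≤ε ⟩
    (2 ℕ.* suc n) × ε              ∎
    where
    open ≤-Reasoning
    a : ℕ
    a = ⌊ n /2⌋
    K≤ : K ℕ.≤ ⌈ n /2⌉
    K≤ = ℕ.≤-trans (ℕ.≤-pred K<L) l≤n/2
    length-bound : suc K ℕ.+ K ℕ.≤ 2 ℕ.* suc n
    length-bound = ℕ.+-mono-≤ (s≤s K≤n) (ℕ.≤-trans (ℕ.m≤n⇒m≤1+n K≤n) (ℕ.m≤m+n (suc n) 0))
      where
      K≤n : K ℕ.≤ n
      K≤n = ℕ.≤-trans K≤ (ℕ.⌈n/2⌉≤n n)
    value₀ : eval c (a ℕ.+ 0) - majority-half (suc n) (a ℕ.+ 0) ≡ eval (translate a c) 0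
    value₀ = trans (cong (λ h → eval c (a ℕ.+ 0) - h) (majority-half-below n))
      (trans (+-identityʳ (eval c (a ℕ.+ 0))) (sym (eval-translate a c 0)))
    near₀ : NearInteger ε (eval (translate a c) 0)
    near₀ = subst (NearInteger ε) value₀
      (near-majority (a ℕ.+ 0) (ℕ.≤-trans (ℕ.≤-reflexive (ℕ.+-identityʳ a)) (ℕ.m≤n⇒m≤1+n (ℕ.⌊n/2⌋≤n n))))
    value₊ : ∀ k → eval c (a ℕ.+ suc k) - majority-half (suc n) (a ℕ.+ suc k) ≡ eval (translate a c) (suc k) - ½
    value₊ k = trans (cong (λ h → eval c (a ℕ.+ suc k) - h) (majority-half-above n k))
      (cong (_- ½) (sym (eval-translate a c (suc k))))
    near₊ : ∀ k → k ℕ.< K → NearInteger ε (eval (translate a c) (suc k) - ½)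
    near₊ k k<K = subst (NearInteger ε) (value₊ k)
      -- From `k < K` and K ≤ ⌈n/2⌉, the weight is at most ⌊n/2⌋ + ⌈n/2⌉ = n.
      (near-majority (a ℕ.+ suc k) (ℕ.m≤n⇒m≤1+n (ℕ.≤-trans (ℕ.+-monoʳ-≤ a (ℕ.≤-trans k<K K≤))
        (ℕ.≤-reflexive (ℕ.⌊n/2⌋+⌈n/2⌉≡n n)))))

  ×-reciprocal : ∀ k .{{_ : ℕ.NonZero k}} → k × (ℤ.+ 1 / k) ≡ 1ℚ
  ×-reciprocal (suc k) = trans (×-/1 (suc k) (ℤ.+ 1 / suc k)) (trans (*-comm _ (ℤ.+ 1 / suc k))
    (/-*-cancel (ℤ.+ 1) k))

  doubled<½ : ∀ t → 10 × t ≡ 1ℚ → t + t < ½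
  doubled<½ t 10t≡1 = subst (_< ½) (sym (begin
    t + t                                ≡⟨ solve 1 (λ t → t :+ t := con ⅕ :* (con (ℤ.+ 10 / 1) :* t)) refl t ⟩
    ⅕ * ((ℤ.+ 10 / 1) * t)               ≡⟨ cong (⅕ *_) (trans (sym (×-/1 10 t)) 10t≡1) ⟩
    ⅕                                    ∎)) (*<* (ℤ.+<+ (s≤s (s≤s (s≤s z≤n)))))
    where
    open ≡-Reasoning
    ⅕ : ℚ
    ⅕ = ℤ.+ 1 / 5

  -- The quantity is 4nε, which is 1/5 when 20nε = 1.
  total-error<½ : ∀ n ε → (20 ℕ.* n) × ε ≡ 1ℚ → (2 ℕ.* n) × (ε + ε) < ½
  total-error<½ n ε 20nε≡1 = subst (_< ½) (sym (×-distrib-+ ε ε (2 ℕ.* n)))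
    (doubled<½ ((2 ℕ.* n) × ε) (trans (×-assocˡ ε 10 (2 ℕ.* n))
      (trans (cong (_× ε) (sym (ℕ.*-assoc 10 2 n))) 20nε≡1)))

-- Contradiction for small degree.

module Conclusion where

  open Counting
  open Majority using (majority-polynomial; no-majority-polynomial; total-error<½; ×-reciprocal; n≤2*⌈n/2⌉)
  open import Defs
  import Data.Integer as ℤ
  open import Data.Nat as ℕ using (ℕ; zero; suc; s≤s; ⌈_/2⌉)
  import Data.Nat.Properties as ℕ
  open import Data.Product using (∃-syntax; _,_) renaming (_×_ to _∧_)
  open import Data.Rational
  open import Data.Rational.Properties
  open import Relation.Binary.PropositionalEquality
  open import Relation.Nullary using (¬_)

  few-majority-codes : ∀ n d → 1 ℕ.≤ n → suc n ℕ.^ (16 ℕ.* (d ℕ.* d)) ℕ.≤ 2 ℕ.^ suc n →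
    ∃[ l ] l ℕ.≤ ⌈ n /2⌉ ∧ suc (suc l ℕ.^ suc d) ℕ.^ suc d ℕ.< 2 ℕ.^ suc l
  -- `few-codes` starts at degree 1. For constants, length 2 and a single moment suffice, since
  -- `suc (2 ^ 1) ^ 1` is 3, below 4.
  few-majority-codes n zero    1≤n _      = 1 , ℕ.⌈n/2⌉-mono 1≤n , ℕ.≤-refl
  few-majority-codes n (suc e) 1≤n sparse = ⌈ n /2⌉ , ℕ.≤-refl ,
    few-codes e (s≤s 1≤n) (s≤s (ℕ.⌈n/2⌉≤n n)) (begin
      suc n                     ≤⟨ s≤s (n≤2*⌈n/2⌉ n) ⟩
      1 ℕ.+ 2 ℕ.* ⌈ n /2⌉       ≤⟨ ℕ.n≤1+n _ ⟩
      2 ℕ.+ 2 ℕ.* ⌈ n /2⌉       ≡⟨ ℕ.*-suc 2 ⌈ n /2⌉ ⟨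
      2 ℕ.* suc ⌈ n /2⌉         ∎) sparse
    where open ℕ.≤-Reasoning

  -- Few enough codes produce a collision, and this forces `½ ≤ (2 * n) × (ε + ε)` for ε = 1/(20n),
  -- where the right side is 1/5.
  not-sparse : ∀ n d → 2 ℕ.≤ n → .{{_ : ℕ.NonZero (20 ℕ.* n)}} → {P : Cube n → 𝕋} →
    IsSymmetricTorusPolynomial d P → P Approximates Maj n within fromℚ (ℤ.+ 1 / (20 ℕ.* n)) →
    ¬ (n ℕ.^ (16 ℕ.* (d ℕ.* d)) ℕ.≤ 2 ℕ.^ n)
  not-sparse (suc n) d (s≤s 1≤n) symmetric approx sparse =
    let 0<ε = positive⁻¹ (ℤ.+ 1 / (20 ℕ.* suc n)) {{normalize-pos 1 (20 ℕ.* suc n)}}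
        c , c≡0 , near = majority-polynomial d 0<ε symmetric approx
        l , l≤ , few = few-majority-codes n d 1≤n sparse
    in <-irrefl refl (<-≤-trans (total-error<½ (suc n) (ℤ.+ 1 / (20 ℕ.* suc n)) (×-reciprocal (20 ℕ.* suc n)))
         (no-majority-polynomial n d l l≤ few (<⇒≤ (+-mono-< 0<ε 0<ε)) c≡0 near))

open LowerBound using (¼; degree-lower-bound)
open Conclusion using (not-sparse)
open import Defs
open import Data.Integer using (+_)
open import Data.Nat using (ℕ; _≤_; _*_; NonZero; >-nonZero)
open import Data.Nat.Properties using (<⇒≤; m*n≢0)
open import Data.Product using (Σ-syntax; _×_; _,_)
open import Data.Rational using (_/_)
import Data.Rational.Properties as ℚ

corollary3p3 :
    Σ[ c ∈ ℝ ] (0ℝ <ℝ c × (∀ (n d : ℕ) (2≤n : 2 ≤ n) →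
      let instance
            n≢0 : NonZero n
            n≢0 = >-nonZero (<⇒≤ 2≤n)
            20n≢0 : NonZero (20 * n)
            20n≢0 = m*n≢0 20 n
      in
      Σ[ P ∈ (Cube n → 𝕋) ]
        (IsSymmetricTorusPolynomial d P ×
         P Approximates Maj n within fromℚ (+ 1 / (20 * n))) →
      c *ℝ √ (fromℕ n ÷ log₂ n ⟨ 0<log₂ n 2≤n ⟩) ≤ℝ fromℕ d))
-- Positivity of the constant asks for a rational strictly between 0 and ¼, which density supplies.
corollary3p3 = fromℚ ¼ , ℚ.<-dense (ℚ.positive⁻¹ ¼) ,
  λ n d 2≤n (P , symmetric , approx) →
    degree-lower-bound n d {{>-nonZero (<⇒≤ 2≤n)}} (0<log₂ n {{>-nonZero (<⇒≤ 2≤n)}} 2≤n)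
      (not-sparse n d 2≤n {{m*n≢0 20 n {{_}} {{>-nonZero (<⇒≤ 2≤n)}}}} symmetric approx)
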